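{- For every positive integer $n$, there is an explicit bijection between the set of $n\times n$ magog matrices and the set of magog triangles of order $n$; consequently the set of $n\times n$ magog matrices is in bijection with the set of all totally symmetric self-complementary plane partitions (TSSCPPs) in a $2n\times 2n\times 2n$ box.
   Context: An $n\times n$ square sign matrix is an $n\times n$ matrix $A=(a_{ij})$ with entries in $\{0,1,-1\}$ such that all row sums and all column sums equal $1$, $0\le \sum_{i'=1}^{i}a_{i'j}\le 1$ for all $1\le i,j\le n$, and $\sum_{j'=1}^{j}a_{ij'}\ge 0$ for all $1\le i,j\le n$. An $n\times n$ magog matrix is a square sign matrix which additionally satisfies, for all $1\le i\le n-2$ and $1\le j\le n-2$, $$\sum_{j'=1}^{j}a_{i+1,j'}+\sum_{i'=1}^{i+1}a_{i',j+1}-\sum_{i'=1}^{i}a_{i'j}\ge 0.$$ A magog triangle of order $n$ is a triangular array of integers $(t_{r,k})$, $1\le k\le r\le n$ (row $r$ has $r$ entries $t_{r,1},\dots,t_{r,r}$), such that all entries are at most $n$, each row is strictly increasing ($t_{r,k}<t_{r,k+1}$), $t_{r+1,k+1}\le t_{r,k}+1$ for all $1\le k\le r\le n-1$, and the bottom row is $t_{n,k}=k$ for $1\le k\le n$. A plane partition is a finite set $\pi$ of lattice points $(i,j,k)$ with positive integer coordinates such that if $(i,j,k)\in\pi$ and $1\le i'\le i$, $1\le j'\le j$, $1\le k'\le k$ then $(i',j',k')\in\pi$. It is totally symmetric if it is invariant under all permutations of the three coordinates. A plane partition contained in the box $\{1,\dots,2n\}^3$ is self-complementary in that box if for every $(i,j,k)$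 in the box, $(i,j,k)\in\pi$ if and only if $(2n+1-i,2n+1-j,2n+1-k)\notin\pi$. A TSSCPP in a $2n\times2n\times2n$ box is a plane partition in that box which is both totally symmetric and self-complementary. -}

module Defs where

open import Data.Nat using (ℕ; zero; suc; _≤_; _∸_) renaming (_+_ to _+ℕ_; _*_ to _*ℕ_)
open import Data.Integer using (ℤ; +_; -_; _+_; _-_) renaming (_≤_ to _≤ℤ_; _<_ to _<ℤ_)
open import Data.Bool using (Bool; true; false; not)
open import Data.Sum using (_⊎_)
open import Data.Product using (Σ; _×_; _,_)
open import Level using (0ℓ)
open import Relation.Binary.PropositionalEquality using (_≡_; refl; sym; trans)
open import Relation.Binary.Bundles using (Setoid)
open import Relation.Binary.Structures using (IsEquivalence)

-- Integer arrays indexed 1-based by natural numbers.  Only the entries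
-- in the relevant index region matter (see the setoids below).

Array : Set
Array = ℕ → ℕ → ℤ

rowPS : Array → ℕ → ℕ → ℤ
rowPS a i zero    = + 0
rowPS a i (suc j) = rowPS a i j + a i (suc j)

colPS : Array → ℕ → ℕ → ℤ
colPS a zero    j = + 0
colPS a (suc i) j = colPS a i j + a (suc i) j

record IsSquareSignMatrix (n : ℕ) (a : Array) : Set where
  field
    entries : ∀ i j → 1 ≤ i → i ≤ n → 1 ≤ j → j ≤ n →
              (a i j ≡ + 0) ⊎ (a i j ≡ + 1) ⊎ (a i j ≡ - (+ 1))
    rowSums : ∀ i → 1 ≤ i → i ≤ n → rowPS a i n ≡ + 1
    colSums : ∀ j → 1 ≤ j → j ≤ n → colPS a n j ≡ + 1
    colPartial : ∀ i j → 1 ≤ i → i ≤ n → 1 ≤ j → j ≤ n →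
                 (+ 0 ≤ℤ colPS a i j) × (colPS a i j ≤ℤ + 1)
    rowPartial : ∀ i j → 1 ≤ i → i ≤ n → 1 ≤ j → j ≤ n →
                 + 0 ≤ℤ rowPS a i j

record IsMagogMatrix (n : ℕ) (a : Array) : Set where
  field
    isSSM : IsSquareSignMatrix n a
    magog : ∀ i j → 1 ≤ i → i ≤ n ∸ 2 → 1 ≤ j → j ≤ n ∸ 2 →
            + 0 ≤ℤ (rowPS a (suc i) j + colPS a (suc i) (suc j)) - colPS a i j

record IsMagogTriangle (n : ℕ) (t : Array) : Set where
  field
    bounded    : ∀ r k → 1 ≤ k → k ≤ r → r ≤ n → t r k ≤ℤ + n
    increasing : ∀ r k → 1 ≤ k → suc k ≤ r → r ≤ n → t r k <ℤ t r (suc k)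
    diagonal   : ∀ r k → 1 ≤ k → k ≤ r → suc r ≤ n → t (suc r) (suc k) ≤ℤ t r k + + 1
    bottom     : ∀ k → 1 ≤ k → k ≤ n → t n k ≡ + k

-- Plane partitions contained in the box {1,…,2n}³, given by their
-- (decidable) membership predicate.

PP : Set
PP = ℕ → ℕ → ℕ → Bool

InBox : ℕ → ℕ → ℕ → ℕ → Set
InBox m i j k = (1 ≤ i × i ≤ m) × (1 ≤ j × j ≤ m) × (1 ≤ k × k ≤ m)

record IsTSSCPP (n : ℕ) (π : PP) : Set where
  field
    inBox    : ∀ i j k → π i j k ≡ true → InBox (2 *ℕ n) i j k
    downward : ∀ i j k i' j' k' → π i j k ≡ true →
               1 ≤ i' → i' ≤ i → 1 ≤ j' → j' ≤ j → 1 ≤ k' → k' ≤ k →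
               π i' j' k' ≡ true
    sym-ikj : ∀ i j k → π i j k ≡ π i k j
    sym-jik : ∀ i j k → π i j k ≡ π j i k
    sym-jki : ∀ i j k → π i j k ≡ π j k i
    sym-kij : ∀ i j k → π i j k ≡ π k i j
    sym-kji : ∀ i j k → π i j k ≡ π k j i
    selfCompl : ∀ i j k → InBox (2 *ℕ n) i j k →
                π i j k ≡ not (π (2 *ℕ n +ℕ 1 ∸ i) (2 *ℕ n +ℕ 1 ∸ j) (2 *ℕ n +ℕ 1 ∸ k))

MagogMatrices : ℕ → Setoid 0ℓ 0ℓ
MagogMatrices n = record
  { Carrier = Σ Array (IsMagogMatrix n)
  ; _≈_ = λ { (a , _) (b , _) → ∀ i j → 1 ≤ i → i ≤ n → 1 ≤ j → j ≤ n → a i j ≡ b i j }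
  ; isEquivalence = record
    { refl  = λ i j _ _ _ _ → refl
    ; sym   = λ p i j a b c d → sym (p i j a b c d)
    ; trans = λ p q i j a b c d → trans (p i j a b c d) (q i j a b c d)
    }
  }

MagogTriangles : ℕ → Setoid 0ℓ 0ℓ
MagogTriangles n = record
  { Carrier = Σ Array (IsMagogTriangle n)
  ; _≈_ = λ { (s , _) (t , _) → ∀ r k → 1 ≤ k → k ≤ r → r ≤ n → s r k ≡ t r k }
  ; isEquivalence = record
    { refl  = λ r k _ _ _ → refl
    ; sym   = λ p r k a b c → sym (p r k a b c)
    ; trans = λ p q r k a b c → trans (p r k a b c) (q r k a b c)
    }
  }

TSSCPPs : ℕ → Setoid 0ℓ 0ℓ
TSSCPPs n = record
  { Carrier = Σ PP (IsTSSCPP n)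
  ; _≈_ = λ { (π , _) (ρ , _) → ∀ i j k → π i j k ≡ ρ i j k }
  ; isEquivalence = record
    { refl  = λ i j k → refl
    ; sym   = λ p i j k → sym (p i j k)
    ; trans = λ p q i j k → trans (p i j k) (q i j k)
    }
  }

{-# OPTIONS --safe #-}
module Submission where

-- Let s r j be the sum of the entries of a matrix in its first r rows and first j columns.
-- Column partial sums in {0,1} make row r of the column-partial-sum matrix a 0-1 vector with
-- r ones; let t r k be the position of its k-th one, so that t r k ≤ j iff k ≤ s r j.  Under
-- this Galois connection the magog inequality, read at a column j holding the k-th one of row
-- r, is t (r+1) (k+1) ≤ t r k + 1, and it is automatic in the last row and the last columns.
--
-- A TSSCPP is determined by its heights b i j above the cells (n+i , n+j) with 1 ≤ i ≤ j ≤ n.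
-- These are arbitrary arrays that decrease in i and in j and satisfy b 1 j ≤ n - j, which are
-- the conditions of a magog triangle for b i j = t j (j+1-i) - (j+1-i).

open import Defs
open import Data.Bool using (Bool; true; false; not; _∧_; if_then_else_)
open import Data.Integer as ℤ using (+_; -_; ∣_∣; +≤+; +<+)
open import Data.Integer.Tactic.RingSolver using (solve-∀)
open import Data.Nat
open import Data.Nat.Properties
open import Data.Product using (_×_; _,_; proj₁; proj₂)
open import Data.Sum using (_⊎_; inj₁; inj₂)
open import Function.Bundles using (Bijection; Inverse; Equivalence)
open import Function.Construct.Composition using (inverse)
open import Function.Definitions using (Congruent; StrictlyInverseˡ; StrictlyInverseʳ)
open import Function.Properties.Inverse using (Inverse⇒Bijection)
open import Level using (0ℓ)
open import Relation.Binary.Bundles using (Setoid)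
open import Relation.Binary.PropositionalEquality
open import Relation.Nullary using (¬_; yes; no; contradiction)
open import Relation.Nullary.Decidable using (dec-true; dec-false)
open import Relation.Unary using (Decidable)
import Data.Bool.Properties as Bool
import Data.Integer.Properties as ℤ
import Function.Consequences.Setoid as Consequences
import Relation.Binary.Construct.On as On

-- Bounded search for the largest number with a decidable property.

module _ {P : ℕ → Set} (P? : Decidable P) where

  -- largest m is 0 when no x with 1 ≤ x ≤ m satisfies P.
  largest : ℕ → ℕ
  largest zero = 0
  largest (suc m) with P? (suc m)
  ... | yes _ = suc m
  ... | no  _ = largest m

  largest≤ : ∀ m → largest m ≤ m
  largest≤ zero = z≤n
  largest≤ (suc m) with P? (suc m)
  ... | yes _ = ≤-refl
  ... | no  _ = m≤n⇒m≤1+n (largest≤ m)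

  ≤largest : ∀ m {x} → x ≤ m → P x → x ≤ largest m
  ≤largest zero x≤0 _ = x≤0
  ≤largest (suc m) x≤ px with P? (suc m)
  ... | yes _ = x≤
  ... | no ¬p with m≤n⇒m<n∨m≡n x≤
  ...   | inj₁ (s≤s x≤m) = ≤largest m x≤m px
  ...   | inj₂ refl      = contradiction px ¬p

  largest-satisfies : ∀ m → 1 ≤ largest m → P (largest m)
  largest-satisfies (suc m) 1≤ with P? (suc m)
  ... | yes p = p
  ... | no  _ = largest-satisfies m 1≤

  -- Downward closure supplies the converse of `≤largest`, so that membership below the bound
  -- becomes a comparison with `largest m`. Closure is asked only at positive numbers, because 0 is
  -- the default of the search and `P 0` may fail.
  ≤largest⁻¹ : ∀ m → (∀ {x y} → 1 ≤ x → x ≤ y → y ≤ m → P y → P x) →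
               ∀ {x} → 1 ≤ x → x ≤ largest m → P x
  ≤largest⁻¹ m down 1≤x x≤ =
    down 1≤x x≤ (largest≤ m) (largest-satisfies m (≤-trans 1≤x x≤))

  -- Guarding `P x` by `1 ≤ x` lets one statement cover the default value 0 as well as a genuine
  -- maximum.
  largest-unique : ∀ m {x} → x ≤ m → (1 ≤ x → P x) →
                   (∀ {y} → 1 ≤ y → y ≤ m → P y → y ≤ x) → largest m ≡ x
  largest-unique m {x} x≤m px above = ≤-antisym upper (lower x≤m px)
    where
    upper : largest m ≤ x
    upper with largest m | largest≤ m | largest-satisfies m
    ... | zero  | _  | _  = z≤n
    ... | suc y | y≤ | py = above (s≤s z≤n) y≤ (py (s≤s z≤n))
    lower : ∀ {x} → x ≤ m → (1 ≤ x → P x) → x ≤ largest m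
    lower {zero}  _  _  = z≤n
    lower {suc x} x≤ px = ≤largest m x≤ (px (s≤s z≤n))

largest-cong : ∀ {P Q : ℕ → Set} (P? : Decidable P) (Q? : Decidable Q) m →
               (∀ x → 1 ≤ x → x ≤ m → P x → Q x) →
               (∀ x → 1 ≤ x → x ≤ m → Q x → P x) → largest P? m ≡ largest Q? m
largest-cong P? Q? m P⇒Q Q⇒P = largest-unique P? m (largest≤ Q? m)
  (λ 1≤ → Q⇒P _ 1≤ (largest≤ Q? m) (largest-satisfies Q? m 1≤))
  (λ 1≤y y≤m py → ≤largest Q? m y≤m (P⇒Q _ 1≤y y≤m py))

-- Arrays up to equality on a region, and inverses between setoids.

ArraysOn : (ℕ → ℕ → Set) → ((ℕ → ℕ → ℕ) → Set) → Setoid 0ℓ 0ℓ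
ArraysOn Region Valid = On.setoid
  (record { _≈_ = λ (f g : ℕ → ℕ → ℕ) → ∀ i j → Region i j → f i j ≡ g i j
          ; isEquivalence = record
            { refl  = λ _ _ _ → refl
            ; sym   = λ p i j x → sym (p i j x)
            ; trans = λ p q i j x → trans (p i j x) (q i j x) } })
  (proj₁ {B = Valid})

strictInverse : (S T : Setoid 0ℓ 0ℓ) → let open Setoid in
  (f : Carrier S → Carrier T) (g : Carrier T → Carrier S) →
  Congruent (_≈_ S) (_≈_ T) f → Congruent (_≈_ T) (_≈_ S) g →
  StrictlyInverseˡ (_≈_ T) f g → StrictlyInverseʳ (_≈_ S) f g → Inverse S T
strictInverse S T f g f-cong g-cong fg gf = record
  { to = f ; from = g ; to-cong = f-cong ; from-cong = g-cong
  ; inverse = (λ {x} {y} → strictlyInverseˡ⇒inverseˡ {f = f} {f⁻¹ = g} f-cong fg {x} {y})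
            , (λ {x} {y} → strictlyInverseʳ⇒inverseʳ {f⁻¹ = g} {f = f} g-cong gf {x} {y}) }
  where open Consequences S T

-- Corner-sum arrays and triangles of natural numbers.

InSquare : ℕ → ℕ → ℕ → Set
InSquare n r j = r ≤ n × j ≤ n

-- magog is the defining inequality of magog matrices in terms of corner sums, with both sides
-- moved so that no subtraction occurs.
record IsCorner (n : ℕ) (s : ℕ → ℕ → ℕ) : Set where
  field
    left   : ∀ r → r ≤ n → s r 0 ≡ 0
    right  : ∀ r → r ≤ n → s r n ≡ r
    bottom : ∀ j → j ≤ n → s n j ≡ j
    mono   : ∀ r j → r ≤ n → j < n → s r j ≤ s r (suc j)
    step   : ∀ r j → r ≤ n → j < n → s r (suc j) ≤ suc (s r j)
    up     : ∀ r j → r < n → j ≤ n → s r j ≤ s (suc r) j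
    magog  : ∀ r j → 1 ≤ r → 2 + r ≤ n → 3 + j ≤ n →
             s r (suc j) + s r (suc j) ≤ s (suc r) (2 + j) + s r j

  mono* : ∀ r {j} j′ → r ≤ n → j ≤ j′ → j′ ≤ n → s r j ≤ s r j′
  mono* r zero     r≤n z≤n _ = ≤-refl
  mono* r (suc j′) r≤n j≤ j′<n with m≤n⇒m<n∨m≡n j≤
  ... | inj₁ (s≤s j≤j′) = ≤-trans (mono* r j′ r≤n j≤j′ (<⇒≤ j′<n)) (mono r j′ r≤n j′<n)
  ... | inj₂ refl       = ≤-refl

  s≤row : ∀ r j → r ≤ n → j ≤ n → s r j ≤ r
  s≤row r j r≤n j≤n = ≤-trans (mono* r n r≤n j≤n ≤-refl) (≤-reflexive (right r r≤n))

  s≤col : ∀ r j → r ≤ n → j ≤ n → s r j ≤ j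
  s≤col r zero    r≤n _   = ≤-reflexive (left r r≤n)
  s≤col r (suc j) r≤n j<n = ≤-trans (step r j r≤n j<n) (s≤s (s≤col r j r≤n (<⇒≤ j<n)))

  top : ∀ j → j ≤ n → s 0 j ≡ 0
  top j j≤n = n≤0⇒n≡0 (s≤row 0 j z≤n j≤n)

  -- In the last row and the last column the magog inequality is automatic.
  magog* : ∀ r j → 1 ≤ r → suc r ≤ n → 2 + j ≤ n →
           s r (suc j) + s r (suc j) ≤ s (suc r) (2 + j) + s r j
  magog* r j 1≤r r<n j<n with m≤n⇒m<n∨m≡n r<n | m≤n⇒m<n∨m≡n j<n
  ... | inj₁ r<n′ | inj₁ j<n′ = magog r j 1≤r r<n′ j<n′
  ... | inj₂ refl | _ = begin
    s r (suc j) + s r (suc j) ≤⟨ +-mono-≤ (s≤col r (suc j) (<⇒≤ r<n) (<⇒≤ j<n)) (step r j (<⇒≤ r<n) (<⇒≤ j<n)) ⟩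
    suc j + suc (s r j)       ≡⟨ +-suc (suc j) (s r j) ⟩
    (2 + j) + s r j           ≡⟨ cong (_+ s r j) (bottom (2 + j) j<n) ⟨
    s (suc r) (2 + j) + s r j ∎
    where open ≤-Reasoning
  ... | inj₁ _ | inj₂ refl = begin
    s r (suc j) + s r (suc j) ≤⟨ +-mono-≤ (s≤row r (suc j) (<⇒≤ r<n) (<⇒≤ j<n)) (step r j (<⇒≤ r<n) (<⇒≤ j<n)) ⟩
    r + suc (s r j)           ≡⟨ +-suc r (s r j) ⟩
    suc r + s r j             ≡⟨ cong (_+ s r j) (right (suc r) r<n) ⟨
    s (suc r) (2 + j) + s r j ∎
    where open ≤-Reasoning

Corners : ℕ → Setoid 0ℓ 0ℓ
Corners n = ArraysOn (InSquare n) (IsCorner n)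

InTriangle : ℕ → ℕ → ℕ → Set
InTriangle n r k = 1 ≤ k × k ≤ r × r ≤ n

-- The field `lower` is a consequence of the conditions on a magog triangle, by `triangle-lower`. It
-- is recorded here because it makes column 0 of `counts` vanish and keeps the subtraction in
-- `excess` from truncating.
record IsNatTriangle (n : ℕ) (t : ℕ → ℕ → ℕ) : Set where
  field
    lower      : ∀ r k → 1 ≤ k → k ≤ r → r ≤ n → k ≤ t r k
    bounded    : ∀ r k → 1 ≤ k → k ≤ r → r ≤ n → t r k ≤ n
    increasing : ∀ r k → 1 ≤ k → suc k ≤ r → r ≤ n → t r k < t r (suc k)
    diagonal   : ∀ r k → 1 ≤ k → k ≤ r → suc r ≤ n → t (suc r) (suc k) ≤ suc (t r k)
    bottom     : ∀ k → 1 ≤ k → k ≤ n → t n k ≡ k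

  mono* : ∀ r {k} k′ → r ≤ n → 1 ≤ k → k ≤ k′ → k′ ≤ r → t r k ≤ t r k′
  mono* r zero     r≤n () z≤n _
  mono* r (suc k′) r≤n 1≤k k≤ k′<r with m≤n⇒m<n∨m≡n k≤
  ... | inj₁ (s≤s k≤k′) = ≤-trans (mono* r k′ r≤n 1≤k k≤k′ (<⇒≤ k′<r))
                                  (<⇒≤ (increasing r k′ (≤-trans 1≤k k≤k′) k′<r r≤n))
  ... | inj₂ refl       = ≤-refl

  -- Compare both entries with `t (suc r) (suc k)`: it exceeds the left side strictly and the right
  -- side by at most one.
  up : ∀ r k → 1 ≤ k → k ≤ r → suc r ≤ n → t (suc r) k ≤ t r k
  up r k 1≤k k≤r r<n =
    s≤s⁻¹ (≤-trans (increasing (suc r) k 1≤k (s≤s k≤r) r<n) (diagonal r k 1≤k k≤r r<n))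

NatTriangles : ℕ → Setoid 0ℓ 0ℓ
NatTriangles n = ArraysOn (InTriangle n) (IsNatTriangle n)

-- The Galois correspondence between corner-sum arrays and triangles.

module _ (n : ℕ) where

  -- The default 0 of `largest` is a correct answer here, since `s r 0` is 0 and hence less than a
  -- positive `k`. The value `n` cannot occur for `k ≤ r`, since `s r n` is `r`.
  beforeOne : (ℕ → ℕ → ℕ) → ℕ → ℕ → ℕ
  beforeOne s r k = largest (λ j → s r j <? k) n

  -- The position of the k-th one in row r of the 0-1 matrix with entries s r j - s r (j-1).
  positions : (ℕ → ℕ → ℕ) → ℕ → ℕ → ℕ
  positions s r k = suc (beforeOne s r k)

  counts : (ℕ → ℕ → ℕ) → ℕ → ℕ → ℕ
  counts t r j = largest (λ k → t r k ≤? j) r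

  module _ {s : ℕ → ℕ → ℕ} (S : IsCorner n s) where
    open IsCorner S

    beforeOne-< : ∀ r k → 1 ≤ k → r ≤ n → s r (beforeOne s r k) < k
    beforeOne-< r k 1≤k r≤n
      with beforeOne s r k | largest-satisfies (λ j → s r j <? k) n
    ... | zero  | _   = subst (_< k) (sym (left r r≤n)) 1≤k
    ... | suc _ | sat = sat (s≤s z≤n)

    beforeOne<n : ∀ r k → InTriangle n r k → beforeOne s r k < n
    beforeOne<n r k (1≤k , k≤r , r≤n) with m≤n⇒m<n∨m≡n (largest≤ (λ j → s r j <? k) n)
    ... | inj₁ c<n = c<n
    ... | inj₂ c≡n = contradiction k≤r (<⇒≱ (subst (_< k)
      (trans (cong (s r) c≡n) (right r r≤n)) (beforeOne-< r k 1≤k r≤n)))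

    ≤-positions : ∀ r k → InTriangle n r k → k ≤ s r (positions s r k)
    ≤-positions r k tri = ≮⇒≥ λ sc<k →
      1+n≰n (≤largest (λ j → s r j <? k) n (beforeOne<n r k tri) sc<k)

    positions-galois→ : ∀ r k j → InTriangle n r k → j ≤ n → positions s r k ≤ j → k ≤ s r j
    positions-galois→ r k j tri@(1≤k , k≤r , r≤n) j≤n t≤j =
      ≤-trans (≤-positions r k tri) (mono* r j r≤n t≤j j≤n)

    positions-galois← : ∀ r k j → InTriangle n r k → k ≤ s r j → positions s r k ≤ j
    positions-galois← r k j tri@(1≤k , k≤r , r≤n) k≤s = ≰⇒> λ j≤c →
      1+n≰n (≤-trans (≤-trans (s≤s (mono* r _ r≤n j≤c (<⇒≤ (beforeOne<n r k tri))))
        (beforeOne-< r k 1≤k r≤n)) k≤s)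

    positions-isNatTriangle : IsNatTriangle n (positions s)
    positions-isNatTriangle = record
      { lower = λ r k 1≤k k≤r r≤n →
          ≤-trans (≤-positions r k (1≤k , k≤r , r≤n))
                  (s≤col r _ r≤n (beforeOne<n r k (1≤k , k≤r , r≤n)))
      ; bounded = λ r k 1≤k k≤r r≤n → beforeOne<n r k (1≤k , k≤r , r≤n)
      -- Passing one column raises the count by at most one, so the column just after
      -- `beforeOne s r k` still has count below `suc k`.
      ; increasing = λ r k 1≤k k<r r≤n →
          let c<n = beforeOne<n r k (1≤k , <⇒≤ k<r , r≤n) in
          s≤s (≤largest (λ j → s r j <? suc k) n c<n
            (s≤s (≤-trans (step r _ r≤n c<n) (beforeOne-< r k 1≤k r≤n))))
      ; diagonal = λ r k 1≤k k≤r r<n → s≤s (diag r k 1≤k k≤r r<n)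
      ; bottom = λ k 1≤k k≤n → ≤-antisym
          (positions-galois← n k k (1≤k , k≤n , ≤-refl) (≤-reflexive (sym (bottom k k≤n))))
          (≤-trans (≤-positions n k (1≤k , k≤n , ≤-refl))
            (≤-reflexive (bottom _ (beforeOne<n n k (1≤k , k≤n , ≤-refl)))))
      }
      where
      -- Write `c` for `beforeOne s r k`. If the claim failed, column `2 + c` of row `suc r` would
      -- have count at most `k`. As `s r (suc c)` is at least `k` and `s r c` is less than `k`, the
      -- magog inequality at `c` would then give `k + k < k + k`.
      diag : ∀ r k → 1 ≤ k → k ≤ r → suc r ≤ n →
             beforeOne s (suc r) (suc k) ≤ positions s r k
      diag r k 1≤k k≤r r<n = ≮⇒≥ λ c<c′ →
        let tri  = 1≤k , k≤r , <⇒≤ r<n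
            c    = beforeOne s r k
            c<n′ = ≤-trans c<c′ (largest≤ (λ j → s (suc r) j <? suc k) n)
        in 1+n≰n (begin-strict
          k + k                                 ≤⟨ +-mono-≤ (≤-positions r k tri) (≤-positions r k tri) ⟩
          s r (suc c) + s r (suc c)             ≤⟨ magog* r c (≤-trans 1≤k k≤r) r<n c<n′ ⟩
          s (suc r) (2 + c) + s r c             <⟨ +-mono-≤-< (s≤s⁻¹ (≤-trans (s≤s (mono* (suc r) _ r<n c<c′ (largest≤ (λ j → s (suc r) j <? suc k) n))) (beforeOne-< (suc r) (suc k) (s≤s z≤n) r<n)))
                                                              (beforeOne-< r k 1≤k (<⇒≤ r<n)) ⟩
          k + k                                 ∎)
        where open ≤-Reasoning

  module _ {t : ℕ → ℕ → ℕ} (T : IsNatTriangle n t) where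
    open IsNatTriangle T

    counts-galois← : ∀ r k j → InTriangle n r k → t r k ≤ j → k ≤ counts t r j
    counts-galois← r k j (_ , k≤r , _) t≤j = ≤largest (λ k → t r k ≤? j) r k≤r t≤j

    counts-galois→ : ∀ r k j → InTriangle n r k → k ≤ counts t r j → t r k ≤ j
    counts-galois→ r k j (1≤k , k≤r , r≤n) = ≤largest⁻¹ (λ k → t r k ≤? j) r
      (λ 1≤x x≤y y≤r ty≤j → ≤-trans (mono* r _ r≤n 1≤x x≤y y≤r) ty≤j) 1≤k

    counts≤r : ∀ r j → counts t r j ≤ r
    counts≤r r j = largest≤ (λ k → t r k ≤? j) r

    counts-isCorner : IsCorner n (counts t)
    counts-isCorner = record
      { left = λ r r≤n → largest-unique (λ k → t r k ≤? 0) r z≤n (λ ())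
          (λ 1≤y y≤r t≤0 → ≤-trans (lower r _ 1≤y y≤r r≤n) t≤0)
      ; right = λ r r≤n → largest-unique (λ k → t r k ≤? n) r ≤-refl
          (λ 1≤r → bounded r r 1≤r ≤-refl r≤n) (λ _ y≤r _ → y≤r)
      ; bottom = λ j j≤n → largest-unique (λ k → t n k ≤? j) n j≤n
          (λ 1≤j → ≤-reflexive (bottom j 1≤j j≤n))
          (λ 1≤y y≤n ty≤j → subst (_≤ j) (bottom _ 1≤y y≤n) ty≤j)
      ; mono = λ r j r≤n j<n → below r j r≤n λ k tri k≤ →
          counts-galois← r k (suc j) tri (m≤n⇒m≤1+n (counts-galois→ r k j tri k≤))
      ; step = λ r j r≤n _ → step′ r j r≤n
      ; up = λ r j r<n j≤n → below r j (<⇒≤ r<n) λ k tri@(1≤k , k≤r , r≤n) k≤ →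
          counts-galois← (suc r) k j (1≤k , m≤n⇒m≤1+n k≤r , r<n)
            (≤-trans (up r k 1≤k k≤r r<n) (counts-galois→ r k j tri k≤))
      ; magog = λ r j _ r<n _ → magog′ r j (<⇒≤ r<n)
      }
      where
      -- A positive count is itself the index of an entry of row `r`, so the Galois connection
      -- applies to it; the count 0 indexes no entry and is split off.
      below : ∀ r j {x} → r ≤ n →
              (∀ k → InTriangle n r k → k ≤ counts t r j → k ≤ x) → counts t r j ≤ x
      below r j r≤n f with counts t r j | counts≤r r j
      ... | zero  | _   = z≤n
      ... | suc k | k<r = f (suc k) (s≤s z≤n , k<r , r≤n) ≤-refl

      -- Rows increase strictly: if entry `2 + k` is at most `suc j`, then entry `suc k` is at most
      -- `j`.
      step′ : ∀ r j → r ≤ n → counts t r (suc j) ≤ suc (counts t r j)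
      step′ r j r≤n = below r (suc j) r≤n λ where
        1             _              _  → s≤s z≤n
        (suc (suc k)) tri@(_ , k<r , _) k≤ → s≤s (counts-galois← r (suc k) j (s≤s z≤n , <⇒≤ k<r , r≤n)
          (s≤s⁻¹ (≤-trans (increasing r (suc k) (s≤s z≤n) k<r r≤n)
                          (counts-galois→ r _ (suc j) tri k≤))))

      -- Let `suc k` be the count at `suc j`. The diagonal condition puts entry `2 + k` of the next
      -- row at or before `2 + j`, so the count there is at least `2 + k`, while `step′` makes the
      -- count at `j` at least `k`.
      magog′ : ∀ r j → r < n →
        counts t r (suc j) + counts t r (suc j) ≤ counts t (suc r) (2 + j) + counts t r j
      magog′ r j r<n = combine refl
        where
        open ≤-Reasoning
        combine : ∀ {x} → x ≡ counts t r (suc j) →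
                  x + x ≤ counts t (suc r) (2 + j) + counts t r j
        combine {zero}  _  = z≤n
        combine {suc k} eq = begin
          suc k + suc k                              ≤⟨ +-monoʳ-≤ (suc k) (≤-trans (≤-reflexive eq) (step′ r j (<⇒≤ r<n))) ⟩
          suc k + suc (counts t r j)                 ≡⟨ +-suc (suc k) (counts t r j) ⟩
          2 + k + counts t r j                       ≤⟨ +-monoˡ-≤ (counts t r j) next ⟩
          counts t (suc r) (2 + j) + counts t r j    ∎
          where
          k<r : suc k ≤ r
          k<r = subst (_≤ r) (sym eq) (counts≤r r (suc j))
          next : 2 + k ≤ counts t (suc r) (2 + j)
          next = counts-galois← (suc r) (2 + k) (2 + j) (s≤s z≤n , s≤s k<r , r<n)
            (≤-trans (diagonal r (suc k) (s≤s z≤n) k<r r<n)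
              (s≤s (counts-galois→ r (suc k) (suc j) (s≤s z≤n , k<r , <⇒≤ r<n) (≤-reflexive eq))))

  corner↔tri : Inverse (Corners n) (NatTriangles n)
  corner↔tri = strictInverse (Corners n) (NatTriangles n)
    (λ (s , S) → positions s , positions-isNatTriangle S)
    (λ (t , T) → counts t , counts-isCorner T)
    (λ {x} {y} eq r k (1≤k , k≤r , r≤n) → cong suc (largest-cong _ _ n
      (λ j _ j≤n → subst (_< k) (eq r j (r≤n , j≤n)))
      (λ j _ j≤n → subst (_< k) (sym (eq r j (r≤n , j≤n))))))
    (λ eq r j (r≤n , j≤n) → largest-cong _ _ r
      (λ k 1≤k k≤r → subst (_≤ j) (eq r k (1≤k , k≤r , r≤n)))
      (λ k 1≤k k≤r → subst (_≤ j) (sym (eq r k (1≤k , k≤r , r≤n)))))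
    -- The two Galois connections combine to say that the old and the new entry have the same upper
    -- bounds `j`; testing this at each of the two entries gives equality. The other composite is
    -- treated in the same way.
    (λ (t , T) r k tri@(1≤k , k≤r , r≤n) → let S = counts-isCorner T in ≤-antisym
      (positions-galois← S r k (t r k) tri (counts-galois← T r k _ tri ≤-refl))
      (counts-galois→ T r k _ tri (≤-positions S r k tri)))
    (λ (s , S) r j (r≤n , j≤n) → let T = positions-isNatTriangle S in
      largest-unique _ r (IsCorner.s≤row S r j r≤n j≤n)
        (λ 1≤k → positions-galois← S r (s r j) j (1≤k , IsCorner.s≤row S r j r≤n j≤n , r≤n) ≤-refl)
        (λ 1≤k k≤r t≤j → positions-galois→ S r _ j (1≤k , k≤r , r≤n) j≤n t≤j))

-- Magog matrices and their corner sums.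

cornerSum : Array → Array
cornerSum a = rowPS (colPS a)

-- Increments in `j` are column partial sums by definition; for increments in `r` the order of
-- summation has to be exchanged.
cornerSum-suc : ∀ a r j → cornerSum a (suc r) j ≡ cornerSum a r j ℤ.+ rowPS a (suc r) j
cornerSum-suc a r zero    = refl
cornerSum-suc a r (suc j) = trans
  (cong (ℤ._+ colPS a (suc r) (suc j)) (cornerSum-suc a r j))
  (interchange (cornerSum a r j) (rowPS a (suc r) j) (colPS a r (suc j)) (a (suc r) (suc j)))
  where
  interchange : ∀ w x y z → (w ℤ.+ x) ℤ.+ (y ℤ.+ z) ≡ (w ℤ.+ y) ℤ.+ (x ℤ.+ z)
  interchange = solve-∀

cornerSum-zero : ∀ a j → cornerSum a 0 j ≡ + 0
cornerSum-zero a zero    = refl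
cornerSum-zero a (suc j) = trans (ℤ.+-identityʳ _) (cornerSum-zero a j)

AgreeOn : ℕ → (a b : Array) → Set
AgreeOn n a b = ∀ i j → 1 ≤ i → i ≤ n → 1 ≤ j → j ≤ n → a i j ≡ b i j

cornerSum-cong : ∀ {n a b} → AgreeOn n a b → ∀ r j → r ≤ n → j ≤ n → cornerSum a r j ≡ cornerSum b r j
cornerSum-cong {n} {a} {b} eq r zero    r≤n _   = refl
cornerSum-cong {n} {a} {b} eq r (suc j) r≤n j<n =
  cong₂ ℤ._+_ (cornerSum-cong eq r j r≤n (<⇒≤ j<n)) (col r r≤n)
  where
  col : ∀ r → r ≤ n → colPS a r (suc j) ≡ colPS b r (suc j)
  col zero    _   = refl
  col (suc r) r<n = cong₂ ℤ._+_ (col r (<⇒≤ r<n)) (eq (suc r) (suc j) (s≤s z≤n) r<n (s≤s z≤n) j<n)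

-- The absolute value only changes the type: within the square the corner sums of a magog matrix are
-- non-negative, as `+corners` uses.
corners : Array → ℕ → ℕ → ℕ
corners a r j = ∣ cornerSum a r j ∣

-- The mixed second difference; the entries of index 0 are junk.
differences : (ℕ → ℕ → ℕ) → Array
differences s (suc r) (suc j) =
  (+ s (suc r) (suc j) ℤ.- + s (suc r) j) ℤ.- (+ s r (suc j) ℤ.- + s r j)
differences s _ _ = + 0

module _ {n : ℕ} {a : Array} (M : IsMagogMatrix n a) where
  open IsMagogMatrix M
  open IsSquareSignMatrix isSSM

  colPS-bounds : ∀ r j → r ≤ n → j < n →
                 (+ 0 ℤ.≤ colPS a r (suc j)) × (colPS a r (suc j) ℤ.≤ + 1)
  colPS-bounds zero    j _   _   = +≤+ z≤n , +≤+ z≤n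
  colPS-bounds (suc r) j r<n j<n = colPartial (suc r) (suc j) (s≤s z≤n) r<n (s≤s z≤n) j<n

  cornerSum-nonneg : ∀ r j → r ≤ n → j ≤ n → + 0 ℤ.≤ cornerSum a r j
  cornerSum-nonneg r zero    _   _   = +≤+ z≤n
  cornerSum-nonneg r (suc j) r≤n j<n =
    ℤ.+-mono-≤ (cornerSum-nonneg r j r≤n (<⇒≤ j<n)) (proj₁ (colPS-bounds r j r≤n j<n))

  +corners : ∀ r j → r ≤ n → j ≤ n → + corners a r j ≡ cornerSum a r j
  +corners r j r≤n j≤n = ℤ.0≤i⇒+∣i∣≡i (cornerSum-nonneg r j r≤n j≤n)

  cornerSum-right : ∀ r → r ≤ n → cornerSum a r n ≡ + r
  cornerSum-right zero    _   = cornerSum-zero a n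
  cornerSum-right (suc r) r<n = begin
    cornerSum a (suc r) n                    ≡⟨ cornerSum-suc a r n ⟩
    cornerSum a r n ℤ.+ rowPS a (suc r) n    ≡⟨ cong₂ ℤ._+_ (cornerSum-right r (<⇒≤ r<n)) (rowSums (suc r) (s≤s z≤n) r<n) ⟩
    + r ℤ.+ + 1                              ≡⟨ ℤ.+-comm (+ r) (+ 1) ⟩
    + suc r                                  ∎
    where open ≡-Reasoning

  cornerSum-bottom : ∀ j → j ≤ n → cornerSum a n j ≡ + j
  cornerSum-bottom zero    _   = refl
  cornerSum-bottom (suc j) j<n = trans
    (cong₂ ℤ._+_ (cornerSum-bottom j (<⇒≤ j<n)) (colSums (suc j) (s≤s z≤n) j<n))
    (ℤ.+-comm (+ j) (+ 1))

  corners-isCorner : IsCorner n (corners a)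
  corners-isCorner = record
    { left   = λ _ _ → refl
    ; right  = λ r r≤n → cong ∣_∣ (cornerSum-right r r≤n)
    ; bottom = λ j j≤n → cong ∣_∣ (cornerSum-bottom j j≤n)
    ; mono   = λ r j r≤n j<n → ℤ.drop‿+≤+ (subst₂ ℤ._≤_
        (trans (ℤ.+-identityʳ _) (sym (+corners r j r≤n (<⇒≤ j<n)))) (sym (+corners r (suc j) r≤n j<n))
        (ℤ.+-monoʳ-≤ (cornerSum a r j) (proj₁ (colPS-bounds r j r≤n j<n))))
    ; step   = λ r j r≤n j<n → ℤ.drop‿+≤+ (subst₂ ℤ._≤_
        (sym (+corners r (suc j) r≤n j<n))
        (trans (cong (ℤ._+ + 1) (sym (+corners r j r≤n (<⇒≤ j<n)))) (ℤ.+-comm (+ corners a r j) (+ 1)))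
        (ℤ.+-monoʳ-≤ (cornerSum a r j) (proj₂ (colPS-bounds r j r≤n j<n))))
    ; up     = λ r j r<n j≤n → ℤ.drop‿+≤+ (subst₂ ℤ._≤_
        (trans (ℤ.+-identityʳ _) (sym (+corners r j (<⇒≤ r<n) j≤n)))
        (trans (sym (cornerSum-suc a r j)) (sym (+corners (suc r) j r<n j≤n)))
        (ℤ.+-monoʳ-≤ (cornerSum a r j) (rowPS-nonneg r j r<n j≤n)))
    -- The corner form counts columns from 0, so its column `j` is column `suc j` of the matrix
    -- inequality.
    ; magog  = λ r j 1≤r r<n j<n → magog-corners r j 1≤r r<n j<n
        (magog r (suc j) 1≤r (∸-monoˡ-≤ 2 r<n) (s≤s z≤n) (∸-monoˡ-≤ 2 j<n))
    }
    where
    rowPS-nonneg : ∀ r j → r < n → j ≤ n → + 0 ℤ.≤ rowPS a (suc r) j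
    rowPS-nonneg r zero    _   _   = +≤+ z≤n
    rowPS-nonneg r (suc j) r<n j<n = rowPartial (suc r) (suc j) (s≤s z≤n) r<n (s≤s z≤n) j<n

    -- With `x`, `y`, `z` the corner sums at `(r , j)`, `(r , j+1)`, `(r+1 , j+2)`, this identifies
    -- the magog expression `p + c - d` with `z + x - 2y`.
    rearrange : ∀ x y z p c d →
      (y ℤ.+ p) ℤ.+ c ≡ z → (x ℤ.+ d) ≡ y →
      z ℤ.+ x ≡ ((p ℤ.+ c) ℤ.- d) ℤ.+ (y ℤ.+ y)
    rearrange x y z p c d refl refl = identity x p c d
      where
      identity : ∀ x p c d → ((x ℤ.+ d) ℤ.+ p) ℤ.+ c ℤ.+ x ≡
                 ((p ℤ.+ c) ℤ.- d) ℤ.+ ((x ℤ.+ d) ℤ.+ (x ℤ.+ d))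
      identity = solve-∀

    magog-corners : ∀ r j → 1 ≤ r → 2 + r ≤ n → 3 + j ≤ n →
      + 0 ℤ.≤ (rowPS a (suc r) (suc j) ℤ.+ colPS a (suc r) (2 + j)) ℤ.- colPS a r (suc j) →
      corners a r (suc j) + corners a r (suc j) ≤ corners a (suc r) (2 + j) + corners a r j
    magog-corners r j 1≤r r<n j<n 0≤ = ℤ.drop‿+≤+ (begin
      + (corners a r (suc j) + corners a r (suc j))              ≡⟨ ℤ.pos-+ (corners a r (suc j)) (corners a r (suc j)) ⟩
      + corners a r (suc j) ℤ.+ + corners a r (suc j)            ≡⟨ cong₂ ℤ._+_ e e ⟩
      y ℤ.+ y                                                    ≡⟨ ℤ.+-identityˡ _ ⟨
      + 0 ℤ.+ (y ℤ.+ y)                                          ≤⟨ ℤ.+-monoˡ-≤ (y ℤ.+ y) 0≤ ⟩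
      ((p ℤ.+ c) ℤ.- d) ℤ.+ (y ℤ.+ y)                            ≡⟨ rearrange x y z p c d (cong (ℤ._+ c) (sym (cornerSum-suc a r (suc j)))) refl ⟨
      z ℤ.+ x                                                    ≡⟨ cong₂ ℤ._+_ (+corners (suc r) (2 + j) (<⇒≤ r<n) (<⇒≤ j<n)) (+corners r j r≤n (≤-trans (n≤1+n j) j<n′)) ⟨
      + corners a (suc r) (2 + j) ℤ.+ + corners a r j            ≡⟨ ℤ.pos-+ (corners a (suc r) (2 + j)) (corners a r j) ⟨
      + (corners a (suc r) (2 + j) + corners a r j)              ∎)
      where
      open ℤ.≤-Reasoning
      r≤n = <⇒≤ (<⇒≤ r<n)
      j<n′ = <⇒≤ (<⇒≤ j<n)
      x = cornerSum a r j
      y = cornerSum a r (suc j)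
      z = cornerSum a (suc r) (2 + j)
      p = rowPS a (suc r) (suc j)
      c = colPS a (suc r) (2 + j)
      d = colPS a r (suc j)
      e = +corners r (suc j) r≤n j<n′

module _ {n : ℕ} {s : ℕ → ℕ → ℕ} (S : IsCorner n s) where
  open IsCorner S

  -- The sum over the rows telescopes down to row 0, which vanishes by `top`.
  colPS-differences : ∀ r j → r ≤ n → j < n →
    colPS (differences s) r (suc j) ≡ + s r (suc j) ℤ.- + s r j
  colPS-differences zero    j _   j<n rewrite top (suc j) j<n | top j (<⇒≤ j<n) = refl
  colPS-differences (suc r) j r<n j<n = trans
    (cong (ℤ._+ differences s (suc r) (suc j)) (colPS-differences r j (<⇒≤ r<n) j<n))
    (cancel (+ s r (suc j) ℤ.- + s r j) (+ s (suc r) (suc j) ℤ.- + s (suc r) j))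
    where
    cancel : ∀ x y → x ℤ.+ (y ℤ.- x) ≡ y
    cancel = solve-∀

  cornerSum-differences : ∀ r j → r ≤ n → j ≤ n → cornerSum (differences s) r j ≡ + s r j
  cornerSum-differences r zero    r≤n _   = cong +_ (sym (left r r≤n))
  cornerSum-differences r (suc j) r≤n j<n = trans
    (cong₂ ℤ._+_ (cornerSum-differences r j r≤n (<⇒≤ j<n)) (colPS-differences r j r≤n j<n))
    (cancel (+ s r j) (+ s r (suc j)))
    where
    cancel : ∀ x y → x ℤ.+ (y ℤ.- x) ≡ y
    cancel = solve-∀

  rowPS-differences : ∀ r j → r < n → j ≤ n →
    rowPS (differences s) (suc r) j ≡ + s (suc r) j ℤ.- + s r j
  rowPS-differences r j r<n j≤n = trans
    (cancel (cornerSum b r j) (rowPS b (suc r) j))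
    (cong₂ ℤ._-_
      (trans (sym (cornerSum-suc b r j)) (cornerSum-differences (suc r) j r<n j≤n))
      (cornerSum-differences r j (<⇒≤ r<n) j≤n))
    where
    b = differences s
    cancel : ∀ x y → y ≡ (x ℤ.+ y) ℤ.- x
    cancel = solve-∀

  differences-isMagog : IsMagogMatrix n (differences s)
  differences-isMagog = record
    { isSSM = record
      { entries = entries
      ; rowSums = λ where
          (suc r) _ r<n → trans (rowPS-differences r n r<n ≤-refl)
            (trans (cong₂ (λ x y → + x ℤ.- + y) (right (suc r) r<n) (right r (<⇒≤ r<n))) (1+x-x (+ r)))
      ; colSums = λ where
          (suc j) _ j<n → trans (colPS-differences n j ≤-refl j<n)
            (trans (cong₂ (λ x y → + x ℤ.- + y) (bottom (suc j) j<n) (bottom j (<⇒≤ j<n))) (1+x-x (+ j)))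
      ; colPartial = colPartial
      ; rowPartial = λ where
          (suc r) j _ r<n _ j≤n → subst (+ 0 ℤ.≤_) (sym (rowPS-differences r j r<n j≤n))
            (ℤ.i≤j⇒0≤j-i (+≤+ (up r j r<n j≤n)))
      }
    ; magog = magog′
    }
    where
    1+x-x : ∀ x → (+ 1 ℤ.+ x) ℤ.- x ≡ + 1
    1+x-x = solve-∀

    -- `mono` and `step` leave only these two values. A matrix entry is the difference of two such
    -- increments, hence 0, 1 or -1.
    increment : ∀ r j → r ≤ n → j < n →
                (+ s r (suc j) ℤ.- + s r j ≡ + 0) ⊎ (+ s r (suc j) ℤ.- + s r j ≡ + 1)
    increment r j r≤n j<n with m≤n⇒m<n∨m≡n (mono r j r≤n j<n)
    ... | inj₂ eq = inj₁ (ℤ.i≡j⇒i-j≡0 (cong +_ (sym eq)))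
    ... | inj₁ lt = inj₂ (trans (cong (λ x → + x ℤ.- + s r j) (≤-antisym (step r j r≤n j<n) lt)) (1+x-x (+ s r j)))

    entries : ∀ i j → 1 ≤ i → i ≤ n → 1 ≤ j → j ≤ n →
      (differences s i j ≡ + 0) ⊎ (differences s i j ≡ + 1) ⊎ (differences s i j ≡ - (+ 1))
    entries (suc r) (suc j) _ r<n _ j<n with increment (suc r) j r<n j<n | increment r j (<⇒≤ r<n) j<n
    ... | inj₁ p | inj₁ q = inj₁ (cong₂ ℤ._-_ p q)
    ... | inj₁ p | inj₂ q = inj₂ (inj₂ (cong₂ ℤ._-_ p q))
    ... | inj₂ p | inj₁ q = inj₂ (inj₁ (cong₂ ℤ._-_ p q))
    ... | inj₂ p | inj₂ q = inj₁ (cong₂ ℤ._-_ p q)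

    colPartial : ∀ i j → 1 ≤ i → i ≤ n → 1 ≤ j → j ≤ n →
      (+ 0 ℤ.≤ colPS (differences s) i j) × (colPS (differences s) i j ℤ.≤ + 1)
    colPartial i (suc j) _ i≤n _ j<n rewrite colPS-differences i j i≤n j<n with increment i j i≤n j<n
    ... | inj₁ p rewrite p = +≤+ z≤n , +≤+ z≤n
    ... | inj₂ p rewrite p = +≤+ z≤n , +≤+ (s≤s z≤n)

    magog′ : ∀ i j → 1 ≤ i → i ≤ n ∸ 2 → 1 ≤ j → j ≤ n ∸ 2 →
      + 0 ℤ.≤ (rowPS (differences s) (suc i) j ℤ.+ colPS (differences s) (suc i) (suc j))
              ℤ.- colPS (differences s) i j
    magog′ i (suc j) 1≤i i≤ _ j≤ = subst (+ 0 ℤ.≤_) (sym value)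
      (ℤ.i≤j⇒0≤j-i (+≤+ (magog i j 1≤i i<n j<n)))
      where
      -- A positive `i` below `n ∸ 2` shows that the subtraction is not truncated, so the bounds can
      -- be moved across it.
      2≤n : 2 ≤ n
      2≤n = <⇒≤ (m∸n≢0⇒n<m λ n∸2≡0 → 1+n≰n (≤-trans 1≤i (≤-trans i≤ (≤-reflexive n∸2≡0))))
      shift : ∀ {x} → x ≤ n ∸ 2 → 2 + x ≤ n
      shift {x} x≤ = subst (_≤ n) (+-comm x 2) (m≤o∸n⇒m+n≤o x 2≤n x≤)
      i<n = shift i≤
      j<n = shift j≤
      identity : ∀ x y z w → ((w ℤ.- y) ℤ.+ (z ℤ.- w)) ℤ.- (y ℤ.- x) ≡ (z ℤ.+ x) ℤ.- (y ℤ.+ y)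
      identity = solve-∀
      value : (rowPS (differences s) (suc i) (suc j) ℤ.+ colPS (differences s) (suc i) (2 + j))
              ℤ.- colPS (differences s) i (suc j)
            ≡ + (s (suc i) (2 + j) + s i j) ℤ.- + (s i (suc j) + s i (suc j))
      value = trans
        (cong₂ ℤ._-_ (cong₂ ℤ._+_
          (rowPS-differences i (suc j) (<⇒≤ i<n) (<⇒≤ (<⇒≤ j<n)))
          (colPS-differences (suc i) (suc j) (<⇒≤ i<n) (<⇒≤ j<n)))
          (colPS-differences i j (<⇒≤ (<⇒≤ i<n)) (<⇒≤ (<⇒≤ j<n))))
        (trans (identity (+ s i j) (+ s i (suc j)) (+ s (suc i) (2 + j)) (+ s (suc i) (suc j)))
          (sym (cong₂ ℤ._-_ (ℤ.pos-+ (s (suc i) (2 + j)) (s i j)) (ℤ.pos-+ (s i (suc j)) (s i (suc j))))))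

matrix↔corner : ∀ n → Inverse (MagogMatrices n) (Corners n)
matrix↔corner n = strictInverse (MagogMatrices n) (Corners n)
  (λ (a , M) → corners a , corners-isCorner M)
  (λ (s , S) → differences s , differences-isMagog S)
  (λ eq r j (r≤n , j≤n) → cong ∣_∣ (cornerSum-cong eq r j r≤n j≤n))
  (λ eq → λ where
    (suc r) (suc j) _ r<n _ j<n → cong₂ ℤ._-_
      (cong₂ (λ x y → + x ℤ.- + y) (eq (suc r) (suc j) (r<n , j<n)) (eq (suc r) j (r<n , <⇒≤ j<n)))
      (cong₂ (λ x y → + x ℤ.- + y) (eq r (suc j) (<⇒≤ r<n , j<n)) (eq r j (<⇒≤ r<n , <⇒≤ j<n))))
  (λ (s , S) r j (r≤n , j≤n) → cong ∣_∣ (cornerSum-differences S r j r≤n j≤n))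
  (λ (a , M) → λ where
    (suc r) (suc j) _ r<n _ j<n → trans
      (cong₂ ℤ._-_
        (cong₂ ℤ._-_ (+corners M (suc r) (suc j) r<n j<n) (+corners M (suc r) j r<n (<⇒≤ j<n)))
        (cong₂ ℤ._-_ (+corners M r (suc j) (<⇒≤ r<n) j<n) (+corners M r j (<⇒≤ r<n) (<⇒≤ j<n))))
      (second-difference (cornerSum a (suc r) j) (cornerSum a r j) (colPS a r (suc j)) (a (suc r) (suc j))))
  where
  second-difference : ∀ x y c e → ((x ℤ.+ (c ℤ.+ e)) ℤ.- x) ℤ.- ((y ℤ.+ c) ℤ.- y) ≡ e
  second-difference = solve-∀

-- Magog triangles of integers as triangles of natural numbers.

module _ {n : ℕ} {t : Array} (T : IsMagogTriangle n t) where
  open IsMagogTriangle T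

  -- Descending induction on the row: the diagonal condition propagates the bottom row upwards.
  triangle-lower : ∀ r k → InTriangle n r k → + k ℤ.≤ t r k
  triangle-lower r k (1≤k , k≤r , r≤n) = climb (n ∸ r) r k (m∸n+n≡m r≤n) 1≤k k≤r
    where
    climb : ∀ d r k → d + r ≡ n → 1 ≤ k → k ≤ r → + k ℤ.≤ t r k
    climb zero    r k refl 1≤k k≤r = ℤ.≤-reflexive (sym (bottom k 1≤k k≤r))
    climb (suc d) r k eq   1≤k k≤r =
      cancel (ℤ.≤-trans (climb d (suc r) (suc k) (trans (+-suc d r) eq) (s≤s z≤n) (s≤s k≤r))
                        (diagonal r k 1≤k k≤r (≤-trans (s≤s (m≤n+m r d)) (≤-reflexive eq))))
      where
      cancel : ∀ {x} → + suc k ℤ.≤ x ℤ.+ + 1 → + k ℤ.≤ x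
      cancel {x} le = subst (+ k ℤ.≤_) (x+1-1 x) (ℤ.+-monoʳ-≤ (- (+ 1)) le)
        where
        x+1-1 : ∀ x → - (+ 1) ℤ.+ (x ℤ.+ + 1) ≡ x
        x+1-1 = solve-∀

  +∣triangle∣ : ∀ r k → InTriangle n r k → + ∣ t r k ∣ ≡ t r k
  +∣triangle∣ r k tri = ℤ.0≤i⇒+∣i∣≡i (ℤ.≤-trans (+≤+ z≤n) (triangle-lower r k tri))

  ∣triangle∣-isNatTriangle : IsNatTriangle n (λ r k → ∣ t r k ∣)
  ∣triangle∣-isNatTriangle = record
    { lower = λ r k 1≤k k≤r r≤n → let tri = 1≤k , k≤r , r≤n in
        ℤ.drop‿+≤+ (subst (+ k ℤ.≤_) (sym (+∣triangle∣ r k tri)) (triangle-lower r k tri))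
    ; bounded = λ r k 1≤k k≤r r≤n →
        ℤ.drop‿+≤+ (subst (ℤ._≤ + n) (sym (+∣triangle∣ r k (1≤k , k≤r , r≤n))) (bounded r k 1≤k k≤r r≤n))
    ; increasing = λ r k 1≤k k<r r≤n → ℤ.drop‿+<+ (subst₂ ℤ._<_
        (sym (+∣triangle∣ r k (1≤k , <⇒≤ k<r , r≤n))) (sym (+∣triangle∣ r (suc k) (s≤s z≤n , k<r , r≤n)))
        (increasing r k 1≤k k<r r≤n))
    ; diagonal = λ r k 1≤k k≤r r<n → ℤ.drop‿+≤+ (subst₂ ℤ._≤_
        (sym (+∣triangle∣ (suc r) (suc k) (s≤s z≤n , s≤s k≤r , r<n)))
        (trans (cong (ℤ._+ + 1) (sym (+∣triangle∣ r k (1≤k , k≤r , <⇒≤ r<n)))) (ℤ.+-comm (+ ∣ t r k ∣) (+ 1)))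
        (diagonal r k 1≤k k≤r r<n))
    ; bottom = λ k 1≤k k≤n → cong ∣_∣ (bottom k 1≤k k≤n)
    }

+tri-isMagogTriangle : ∀ {n t} → IsNatTriangle n t → IsMagogTriangle n (λ r k → + t r k)
+tri-isMagogTriangle {n} {t} T = record
  { bounded    = λ r k 1≤k k≤r r≤n → +≤+ (bounded r k 1≤k k≤r r≤n)
  ; increasing = λ r k 1≤k k<r r≤n → +<+ (increasing r k 1≤k k<r r≤n)
  ; diagonal   = λ r k 1≤k k≤r r<n → subst (+ t (suc r) (suc k) ℤ.≤_) (ℤ.+-comm (+ 1) (+ t r k))
      (+≤+ (diagonal r k 1≤k k≤r r<n))
  ; bottom     = λ k 1≤k k≤n → cong +_ (bottom k 1≤k k≤n)
  }
  where open IsNatTriangle T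

tri↔triangle : ∀ n → Inverse (NatTriangles n) (MagogTriangles n)
tri↔triangle n = strictInverse (NatTriangles n) (MagogTriangles n)
  (λ (t , T) → (λ r k → + t r k) , +tri-isMagogTriangle T)
  (λ (t , T) → (λ r k → ∣ t r k ∣) , ∣triangle∣-isNatTriangle T)
  (λ eq r k 1≤k k≤r r≤n → cong +_ (eq r k (1≤k , k≤r , r≤n)))
  (λ eq r k (1≤k , k≤r , r≤n) → cong ∣_∣ (eq r k 1≤k k≤r r≤n))
  (λ (t , T) r k 1≤k k≤r r≤n → +∣triangle∣ T r k (1≤k , k≤r , r≤n))
  (λ _ _ _ _ → refl)

-- Excess arrays of magog triangles.

InUpper : ℕ → ℕ → ℕ → Set
InUpper n i j = 1 ≤ i × i ≤ j × j ≤ n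

-- b i j is the amount by which the i-th entry from the right in row j of a magog triangle
-- exceeds its least possible value.
record IsExcess (n : ℕ) (b : ℕ → ℕ → ℕ) : Set where
  field
    bound      : ∀ i j → InUpper n i j → b i j + j ≤ n
    decreasingˡ : ∀ i j → 1 ≤ i → suc i ≤ j → j ≤ n → b (suc i) j ≤ b i j
    decreasingʳ : ∀ i j → 1 ≤ i → i ≤ j → suc j ≤ n → b i (suc j) ≤ b i j

  -- The first index is moved at column `j′`, and only then the second one in row `i`; in this order
  -- the path never leaves the region where the row index is at most the column index.
  antitone : ∀ {i j i′ j′} → InUpper n i j → InUpper n i′ j′ → i ≤ i′ → j ≤ j′ → b i′ j′ ≤ b i j
  antitone {i} {j} {i′} {j′} (1≤i , i≤j , _) (_ , i′≤j′ , j′≤n) i≤i′ j≤j′ =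
    ≤-trans (left i′ i≤i′ i′≤j′) (right j′ j≤j′ j′≤n)
    where
    left : ∀ x → i ≤ x → x ≤ j′ → b x j′ ≤ b i j′
    left zero    z≤n _    = ≤-refl
    left (suc x) i≤  x<j′ with m≤n⇒m<n∨m≡n i≤
    ... | inj₂ refl      = ≤-refl
    ... | inj₁ (s≤s i≤x) = ≤-trans (decreasingˡ x j′ (≤-trans 1≤i i≤x) x<j′ j′≤n)
                                   (left x i≤x (<⇒≤ x<j′))
    right : ∀ y → j ≤ y → y ≤ n → b i y ≤ b i j
    right zero    z≤n _   = ≤-refl
    right (suc y) j≤  y<n with m≤n⇒m<n∨m≡n j≤
    ... | inj₂ refl      = ≤-refl
    ... | inj₁ (s≤s j≤y) = ≤-trans (decreasingʳ i y 1≤i (≤-trans i≤j j≤y) y<n)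
                                   (right y j≤y (<⇒≤ y<n))

Excesses : ℕ → Setoid 0ℓ 0ℓ
Excesses n = ArraysOn (InUpper n) (IsExcess n)

-- Row `j` has `j` entries, so the `i`-th from the right has index `suc j ∸ i`, and this index is
-- also its least possible value.
excess : (ℕ → ℕ → ℕ) → ℕ → ℕ → ℕ
excess t i j = t j (suc j ∸ i) ∸ (suc j ∸ i)

unexcess : (ℕ → ℕ → ℕ) → ℕ → ℕ → ℕ
unexcess b r k = k + b (suc r ∸ k) r

-- i ↦ suc j ∸ i is an involution of {1,…,j}.
reflect : ∀ {n i j} → InUpper n i j → InTriangle n j (suc j ∸ i)
reflect {i = i} {j} (1≤i , i≤j , j≤n) = m<n⇒0<n∸m (s≤s i≤j) , ∸-monoʳ-≤ (suc j) 1≤i , j≤n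

reflect⁻¹ : ∀ {n r k} → InTriangle n r k → InUpper n (suc r ∸ k) r
reflect⁻¹ {r = r} (1≤k , k≤r , r≤n) = m<n⇒0<n∸m (s≤s k≤r) , ∸-monoʳ-≤ (suc r) 1≤k , r≤n

-- Strict increase along a row turns into decrease in `i`, and the diagonal condition turns into
-- decrease in `j`.
excess-isExcess : ∀ {n t} → IsNatTriangle n t → IsExcess n (excess t)
excess-isExcess {n} {t} T = record
  { bound = λ { (suc i) j (1≤i , i<j , j≤n) →
      let tri@(1≤m , m≤j , _) = reflect (1≤i , i<j , j≤n)
          m+i≡j = m∸n+n≡m (<⇒≤ i<j) in
      begin
        excess t (suc i) j + j                     ≡⟨ cong (λ x → excess t (suc i) j + x) m+i≡j ⟨
        excess t (suc i) j + ((j ∸ i) + i)         ≡⟨ +-assoc (excess t (suc i) j) (j ∸ i) i ⟨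
        excess t (suc i) j + (j ∸ i) + i           ≡⟨ cong (_+ i) (m∸n+n≡m (lower j (j ∸ i) 1≤m m≤j j≤n)) ⟩
        t j (j ∸ i) + i                            ≤⟨ room i j (j ∸ i) m+i≡j 1≤m j≤n ⟩
        n                                          ∎ }
  ; decreasingˡ = λ { (suc i) j 1≤i i<j j≤n → rowˡ i j i<j j≤n }
  ; decreasingʳ = λ i j 1≤i i≤j j<n → colʳ i j 1≤i i≤j j<n
  }
  where
  open IsNatTriangle T
  open ≤-Reasoning

  -- To the right of entry `m` there are `i` further entries, strictly increasing and at most `n`.
  room : ∀ i j m → m + i ≡ j → 1 ≤ m → j ≤ n → t j m + i ≤ n
  room zero    j m eq 1≤m j≤n = subst (_≤ n) (sym (+-identityʳ (t j m)))
    (bounded j m 1≤m (≤-reflexive (trans (sym (+-identityʳ m)) eq)) j≤n)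
  room (suc i) j m eq 1≤m j≤n = begin
    t j m + suc i     ≡⟨ +-suc (t j m) i ⟩
    suc (t j m) + i   ≤⟨ +-monoˡ-≤ i (increasing j m 1≤m m<j j≤n) ⟩
    t j (suc m) + i   ≤⟨ room i j (suc m) (trans (sym (+-suc m i)) eq) (s≤s z≤n) j≤n ⟩
    n                 ∎
    where
    m<j : suc m ≤ j
    m<j = ≤-trans (m≤m+n (suc m) i) (≤-reflexive (trans (sym (+-suc m i)) eq))

  rowˡ : ∀ i j → suc (suc i) ≤ j → j ≤ n → excess t (2 + i) j ≤ excess t (suc i) j
  rowˡ i j i<j j≤n = subst (λ m → t j (j ∸ suc i) ∸ (j ∸ suc i) ≤ t j m ∸ m) eq
      (∸-monoˡ-≤ (suc (j ∸ suc i)) (increasing j (j ∸ suc i) (m<n⇒0<n∸m i<j)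
         (≤-trans (≤-reflexive eq) (m∸n≤m j i)) j≤n))
    where
    eq : suc (j ∸ suc i) ≡ j ∸ i
    eq = suc-∸ i<j
      where
      suc-∸ : ∀ {i j} → suc (suc i) ≤ j → suc (j ∸ suc i) ≡ j ∸ i
      suc-∸ {i} {suc j} (s≤s i<j) = sym (+-∸-assoc 1 (<⇒≤ i<j))

  colʳ : ∀ i j → 1 ≤ i → i ≤ j → suc j ≤ n → excess t i (suc j) ≤ excess t i j
  colʳ i j 1≤i i≤j j<n rewrite +-∸-assoc 1 {suc j} {i} (m≤n⇒m≤1+n i≤j) =
    let (1≤m , m≤j , _) = reflect (1≤i , i≤j , <⇒≤ j<n) in
    ∸-monoˡ-≤ (suc (suc j ∸ i)) (diagonal j (suc j ∸ i) 1≤m m≤j j<n)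

unexcess-isNatTriangle : ∀ {n b} → IsExcess n b → IsNatTriangle n (unexcess b)
unexcess-isNatTriangle {n} {b} B = record
  { lower = λ r k _ _ _ → m≤m+n k _
  ; bounded = λ r k 1≤k k≤r r≤n → ≤-trans (+-monoˡ-≤ _ k≤r)
      (≤-trans (≤-reflexive (+-comm r _)) (bound _ r (reflect⁻¹ (1≤k , k≤r , r≤n))))
  ; increasing = λ r k 1≤k k<r r≤n → s≤s (+-monoʳ-≤ k
      (subst (λ i → b i r ≤ b (r ∸ k) r) (sym (+-∸-assoc 1 (<⇒≤ k<r)))
        (decreasingˡ (r ∸ k) r (m<n⇒0<n∸m k<r) (∸-monoʳ-< 1≤k (<⇒≤ k<r)) r≤n)))
  ; diagonal = λ r k 1≤k k≤r r<n → s≤s (+-monoʳ-≤ k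
      (decreasingʳ (suc r ∸ k) r (m<n⇒0<n∸m (s≤s k≤r)) (∸-monoʳ-≤ (suc r) 1≤k) r<n))
  -- In column `n` the bound reads `b i n + n ≤ n` and forces the excess to be 0.
  ; bottom = λ k 1≤k k≤n → trans
      (cong (λ x → k + x) (n≤0⇒n≡0 (+-cancelʳ-≤ n _ 0 (bound _ n (reflect⁻¹ (1≤k , k≤n , ≤-refl))))))
      (+-identityʳ k)
  }
  where open IsExcess B

reflect-involutive : ∀ {i j} → i ≤ j → suc j ∸ (suc j ∸ i) ≡ i
reflect-involutive i≤j = m∸[m∸n]≡n (m≤n⇒m≤1+n i≤j)

tri↔excess : ∀ n → Inverse (NatTriangles n) (Excesses n)
tri↔excess n = strictInverse (NatTriangles n) (Excesses n)
  (λ (t , T) → excess t , excess-isExcess T)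
  (λ (b , B) → unexcess b , unexcess-isNatTriangle B)
  (λ eq i j up → cong (_∸ (suc j ∸ i)) (eq j (suc j ∸ i) (reflect up)))
  (λ eq r k tri → cong (λ x → k + x) (eq (suc r ∸ k) r (reflect⁻¹ tri)))
  (λ (b , B) i j (_ , i≤j , _) → trans (m+n∸m≡n (suc j ∸ i) _)
     (cong (λ x → b x j) (reflect-involutive i≤j)))
  (λ (t , T) r k (1≤k , k≤r , r≤n) → trans
     (cong (λ m → k + (t r m ∸ m)) (reflect-involutive k≤r))
     (m+[n∸m]≡n (IsNatTriangle.lower T r k 1≤k k≤r r≤n)))

-- Boolean comparisons and sorting of triples.

≤⇒≤ᵇ≡true : ∀ {m n} → m ≤ n → (m ≤ᵇ n) ≡ true
≤⇒≤ᵇ≡true {m} {n} = dec-true (m ≤? n)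

≰⇒≤ᵇ≡false : ∀ {m n} → ¬ (m ≤ n) → (m ≤ᵇ n) ≡ false
≰⇒≤ᵇ≡false {m} {n} = dec-false (m ≤? n)

≤ᵇ≡true⇒≤ : ∀ {m n} → (m ≤ᵇ n) ≡ true → m ≤ n
≤ᵇ≡true⇒≤ {m} {n} eq = ≤ᵇ⇒≤ m n (Bool.T-≡ .Equivalence.from eq)

-- Written as lattice polynomials, the minimum, median and maximum are visibly monotone, and their
-- symmetry follows from the lattice laws.
lo mid hi : ℕ → ℕ → ℕ → ℕ
lo  i j k = i ⊓ j ⊓ k
mid i j k = (i ⊓ j) ⊔ (i ⊓ k) ⊔ (j ⊓ k)
hi  i j k = i ⊔ j ⊔ k

lo≤mid : ∀ i j k → lo i j k ≤ mid i j k
lo≤mid i j k = ≤-trans (m⊓n≤m (i ⊓ j) k) (≤-trans (m≤m⊔n (i ⊓ j) (i ⊓ k)) (m≤m⊔n _ (j ⊓ k)))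

mid≤hi : ∀ i j k → mid i j k ≤ hi i j k
mid≤hi i j k = ⊔-lub (⊔-lub
  (≤-trans (m⊓n≤m i j) i≤hi) (≤-trans (m⊓n≤m i k) i≤hi))
  (≤-trans (m⊓n≤m j k) (≤-trans (m≤n⊔m i j) (m≤m⊔n (i ⊔ j) k)))
  where
  i≤hi : i ≤ hi i j k
  i≤hi = ≤-trans (m≤m⊔n i j) (m≤m⊔n (i ⊔ j) k)

cong₃ : ∀ {A : Set} (f : ℕ → ℕ → ℕ → A) {x x′ y y′ z z′} →
            x ≡ x′ → y ≡ y′ → z ≡ z′ → f x y z ≡ f x′ y′ z′
cong₃ f refl refl refl = refl

module _ {A : Set} (f : ℕ → ℕ → ℕ → A) where

  onSorted : ℕ → ℕ → ℕ → A
  onSorted i j k = f (lo i j k) (mid i j k) (hi i j k)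

  onSorted-swap₁₂ : ∀ i j k → onSorted i j k ≡ onSorted j i k
  onSorted-swap₁₂ i j k = cong₃ f
    (cong (_⊓ k) (⊓-comm i j))
    (trans (⊔-assoc (i ⊓ j) (i ⊓ k) (j ⊓ k))
      (trans (cong₂ _⊔_ (⊓-comm i j) (⊔-comm (i ⊓ k) (j ⊓ k))) (sym (⊔-assoc (j ⊓ i) (j ⊓ k) (i ⊓ k)))))
    (cong (_⊔ k) (⊔-comm i j))

  onSorted-swap₂₃ : ∀ i j k → onSorted i j k ≡ onSorted i k j
  onSorted-swap₂₃ i j k = cong₃ f
    (trans (⊓-assoc i j k) (trans (cong (i ⊓_) (⊓-comm j k)) (sym (⊓-assoc i k j))))
    (cong₂ _⊔_ (⊔-comm (i ⊓ j) (i ⊓ k)) (⊓-comm j k))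
    (trans (⊔-assoc i j k) (trans (cong (i ⊔_) (⊔-comm j k)) (sym (⊔-assoc i k j))))

  onSorted-sorted : ∀ {i j k} → i ≤ j → j ≤ k → onSorted i j k ≡ f i j k
  onSorted-sorted {i} {j} {k} i≤j j≤k = cong₃ f
    (trans (cong (_⊓ k) (m≤n⇒m⊓n≡m i≤j)) (m≤n⇒m⊓n≡m i≤k))
    (trans (cong₂ _⊔_ (trans (cong₂ _⊔_ (m≤n⇒m⊓n≡m i≤j) (m≤n⇒m⊓n≡m i≤k)) (⊔-idem i)) (m≤n⇒m⊓n≡m j≤k))
           (m≤n⇒m⊔n≡n i≤j))
    (trans (cong (_⊔ k) (m≤n⇒m⊔n≡n i≤j)) (m≤n⇒m⊔n≡n j≤k))
    where i≤k = ≤-trans i≤j j≤k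

-- Adjacent transpositions generate all permutations: each of the six orders is at most three swaps
-- away from the sorted one.
sorted-suffices : (P : ℕ → ℕ → ℕ → Set) →
  (∀ {i j k} → P i j k → P j i k) → (∀ {i j k} → P i j k → P i k j) →
  (∀ {x y z} → x ≤ y → y ≤ z → P x y z) → ∀ i j k → P i j k
sorted-suffices P s₁₂ s₂₃ base i j k with ≤-total i j | ≤-total j k | ≤-total i k
... | inj₁ i≤j | inj₁ j≤k | _        = base i≤j j≤k
... | inj₁ i≤j | inj₂ k≤j | inj₁ i≤k = s₂₃ (base i≤k k≤j)
... | inj₁ i≤j | inj₂ k≤j | inj₂ k≤i = s₂₃ (s₁₂ (base k≤i i≤j))
... | inj₂ j≤i | inj₁ j≤k | inj₁ i≤k = s₁₂ (base j≤i i≤k)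
... | inj₂ j≤i | inj₁ j≤k | inj₂ k≤i = s₁₂ (s₂₃ (base j≤k k≤i))
... | inj₂ j≤i | inj₂ k≤j | _        = s₁₂ (s₂₃ (s₁₂ (base k≤j j≤i)))

true-ext : ∀ {u v} → (u ≡ true → v ≡ true) → (v ≡ true → u ≡ true) → u ≡ v
true-ext {true}  {true}  _ _ = refl
true-ext {true}  {false} f _ = sym (f refl)
true-ext {false} {true}  _ g = g refl
true-ext {false} {false} _ _ = refl

-- From excess arrays to TSSCPPs.

module _ (n : ℕ) where

  complement : ℕ → ℕ
  complement x = 2 * n + 1 ∸ x

  2n+1≡n+[1+n] : 2 * n + 1 ≡ n + suc n
  2n+1≡n+[1+n] = trans (+-comm (2 * n) 1) (trans (cong (λ x → suc (n + x)) (+-identityʳ n)) (sym (+-suc n n)))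

  ≤2n⇒≤2n+1 : ∀ {x} → x ≤ 2 * n → x ≤ 2 * n + 1
  ≤2n⇒≤2n+1 x≤ = ≤-trans x≤ (m≤m+n (2 * n) 1)

  complement-involutive : ∀ {x} → x ≤ 2 * n → complement (complement x) ≡ x
  complement-involutive x≤ = m∸[m∸n]≡n (≤2n⇒≤2n+1 x≤)

  complement-antitone : ∀ {x y} → x ≤ y → complement y ≤ complement x
  complement-antitone = ∸-monoʳ-≤ (2 * n + 1)

  complement-positive : ∀ {x} → x ≤ 2 * n → 1 ≤ complement x
  complement-positive {x} x≤ = m<n⇒0<n∸m (≤-trans (s≤s x≤) (≤-reflexive (+-comm 1 (2 * n))))

  complement≤2n : ∀ {x} → 1 ≤ x → complement x ≤ 2 * n
  complement≤2n 1≤x = ≤-trans (complement-antitone 1≤x) (≤-reflexive (m+n∸n≡m (2 * n) 1))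

  complement-low : ∀ {x} → x ≤ n → n < complement x
  complement-low {x} x≤n = m+n≤o⇒m≤o∸n (suc n) (≤-trans (+-monoʳ-≤ (suc n) x≤n)
    (≤-reflexive (trans (+-comm (suc n) n) (sym 2n+1≡n+[1+n]))))

  complement-high : ∀ {x} → n < x → complement x ≤ n
  complement-high {x} n<x = m≤n+o⇒m∸n≤o (2 * n + 1) x (≤-trans (≤-reflexive
    (trans 2n+1≡n+[1+n] (+-comm n (suc n)))) (+-monoˡ-≤ n n<x))

  -- The points of a TSSCPP with all coordinates ≤ n are all present and those with
  -- all coordinates > n all absent, so the heights b i j above the cells (n + i , n + j)
  -- determine it: by symmetry the points with two coordinates > n, and by
  -- self-complementarity those with one.
  upper : (ℕ → ℕ → ℕ) → ℕ → ℕ → ℕ → Bool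
  upper b x y z = x ≤ᵇ b (y ∸ n) (z ∸ n)

  -- For sorted arguments the median `y` tells whether at least two coordinates are at most `n`.
  -- Complementation reverses order, so the complemented triple is sorted when listed backwards. For
  -- an excess array the two extreme cubes come out right as well, since the heights are at most
  -- `n`.
  sortedSolid : (ℕ → ℕ → ℕ) → ℕ → ℕ → ℕ → Bool
  sortedSolid b x y z = (1 ≤ᵇ x) ∧ (z ≤ᵇ 2 * n) ∧
    (if y ≤ᵇ n then not (upper b (complement z) (complement y) (complement x)) else upper b x y z)

  solid : (ℕ → ℕ → ℕ) → PP
  solid b = onSorted (sortedSolid b)

  -- For positive `i` and `j` the search may stop at `n`: by `corner-absent` a TSSCPP has no higher
  -- point above such a cell.
  heights : PP → ℕ → ℕ → ℕ
  heights π i j = largest (λ k → π (n + i) (n + j) k Bool.≟ true) n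

  upper-region : ∀ {y z} → n < y → y ≤ z → z ≤ 2 * n → InUpper n (y ∸ n) (z ∸ n)
  upper-region n<y y≤z z≤2n = m<n⇒0<n∸m n<y , ∸-monoˡ-≤ n y≤z ,
    m≤n+o⇒m∸n≤o _ n (≤-trans z≤2n (≤-reflexive (cong (λ x → n + x) (+-identityʳ n))))

  module _ (b : ℕ → ℕ → ℕ) {x y z : ℕ} where

    sortedSolid⇒box : sortedSolid b x y z ≡ true → 1 ≤ x × z ≤ 2 * n
    sortedSolid⇒box eq with 1 ≤ᵇ x in 1≤x | z ≤ᵇ 2 * n in z≤2n
    ... | true | true = ≤ᵇ≡true⇒≤ 1≤x , ≤ᵇ≡true⇒≤ z≤2n

    sortedSolid-low : 1 ≤ x → z ≤ 2 * n → y ≤ n →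
      sortedSolid b x y z ≡ not (upper b (complement z) (complement y) (complement x))
    sortedSolid-low 1≤x z≤2n y≤n
      rewrite ≤⇒≤ᵇ≡true 1≤x | ≤⇒≤ᵇ≡true z≤2n | ≤⇒≤ᵇ≡true y≤n = refl

    sortedSolid-high : 1 ≤ x → z ≤ 2 * n → n < y → sortedSolid b x y z ≡ upper b x y z
    sortedSolid-high 1≤x z≤2n n<y
      rewrite ≤⇒≤ᵇ≡true 1≤x | ≤⇒≤ᵇ≡true z≤2n | ≰⇒≤ᵇ≡false (<⇒≱ n<y) = refl

    -- Applied with `v` the membership in a given TSSCPP, and with `v` the solid of a second array
    -- that agrees on the region.
    sortedSolid-unique : ∀ {v} → (v ≡ true → 1 ≤ x × z ≤ 2 * n) →
      (1 ≤ x → z ≤ 2 * n → y ≤ n → v ≡ not (upper b (complement z) (complement y) (complement x))) →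
      (1 ≤ x → z ≤ 2 * n → n < y → v ≡ upper b x y z) →
      sortedSolid b x y z ≡ v
    sortedSolid-unique {v} box low high = true-ext
      (λ eq → let (1≤x , z≤2n) = sortedSolid⇒box eq in trans (sym (agree 1≤x z≤2n)) eq)
      (λ eq → let (1≤x , z≤2n) = box eq in trans (agree 1≤x z≤2n) eq)
      where
      agree : 1 ≤ x → z ≤ 2 * n → sortedSolid b x y z ≡ v
      agree 1≤x z≤2n with ≤-<-connex y n
      ... | inj₁ y≤n = trans (sortedSolid-low 1≤x z≤2n y≤n) (sym (low 1≤x z≤2n y≤n))
      ... | inj₂ n<y = trans (sortedSolid-high 1≤x z≤2n n<y) (sym (high 1≤x z≤2n n<y))

  not-true : ∀ {u} → not u ≡ true → u ≡ false
  not-true {false} _ = refl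

  module _ {b : ℕ → ℕ → ℕ} (B : IsExcess n b) where
    open IsExcess B

    upper-antitone : ∀ {x y z x′ y′ z′} → n < y → y ≤ z → y′ ≤ z′ → z′ ≤ 2 * n →
      x ≤ x′ → y ≤ y′ → z ≤ z′ → upper b x′ y′ z′ ≡ true → upper b x y z ≡ true
    upper-antitone n<y y≤z y′≤z′ z′≤2n x≤x′ y≤y′ z≤z′ eq = ≤⇒≤ᵇ≡true
      (≤-trans x≤x′ (≤-trans (≤ᵇ≡true⇒≤ eq) (antitone
        (upper-region n<y y≤z (≤-trans z≤z′ z′≤2n))
        (upper-region (≤-trans n<y y≤y′) y′≤z′ z′≤2n)
        (∸-monoˡ-≤ n y≤y′) (∸-monoˡ-≤ n z≤z′))))

    -- This is `bound` in the coordinates of the box. It prevents a present point with two high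
    -- coordinates from dominating an absent one with two low coordinates.
    upper-bound : ∀ {x y z} → n < y → y ≤ z → z ≤ 2 * n → upper b x y z ≡ true → x + z ≤ 2 * n
    upper-bound {x} {y} {z} n<y y≤z z≤2n eq = begin
      x + z                              ≡⟨ cong (λ w → x + w) (m∸n+n≡m (<⇒≤ (≤-trans n<y y≤z))) ⟨
      x + (z ∸ n + n)                    ≡⟨ +-assoc x (z ∸ n) n ⟨
      x + (z ∸ n) + n                    ≤⟨ +-monoˡ-≤ n (+-monoˡ-≤ (z ∸ n) (≤ᵇ≡true⇒≤ eq)) ⟩
      b (y ∸ n) (z ∸ n) + (z ∸ n) + n    ≤⟨ +-monoˡ-≤ n (bound _ _ (upper-region n<y y≤z z≤2n)) ⟩
      n + n                              ≡⟨ cong (λ w → n + w) (+-identityʳ n) ⟨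
      2 * n                              ∎
      where open ≤-Reasoning

    sortedSolid-down : ∀ {x y z x′ y′ z′} → x ≤ y → y ≤ z → x′ ≤ y′ → y′ ≤ z′ →
      1 ≤ x → x ≤ x′ → y ≤ y′ → z ≤ z′ →
      sortedSolid b x′ y′ z′ ≡ true → sortedSolid b x y z ≡ true
    sortedSolid-down {x} {y} {z} {x′} {y′} {z′} x≤y y≤z x′≤y′ y′≤z′ 1≤x x≤x′ y≤y′ z≤z′ eq
      with (1≤x′ , z′≤2n) ← sortedSolid⇒box b {x′} {y′} {z′} eq
      with z≤2n ← ≤-trans z≤z′ z′≤2n
      with ≤-<-connex y n | ≤-<-connex y′ n
    ... | inj₂ n<y | inj₁ y′≤n = contradiction (≤-trans y≤y′ y′≤n) (<⇒≱ n<y)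
    ... | inj₂ n<y | inj₂ n<y′ = trans (sortedSolid-high b 1≤x z≤2n n<y)
      (upper-antitone n<y y≤z y′≤z′ z′≤2n x≤x′ y≤y′ z≤z′
        (trans (sym (sortedSolid-high b 1≤x′ z′≤2n n<y′)) eq))
    -- Complementation reverses the order of the two points, so if the complement of the smaller one
    -- were present, that of the larger one would be too.
    ... | inj₁ y≤n | inj₁ y′≤n = trans (sortedSolid-low b 1≤x z≤2n y≤n)
      (cong not (Bool.¬-not λ up → contradiction
        (trans (sym (upper-antitone (complement-low y′≤n) (complement-antitone x′≤y′)
            (complement-antitone x≤y) (complement≤2n 1≤x)
            (complement-antitone z≤z′) (complement-antitone y≤y′) (complement-antitone x≤x′) up))
          (not-true (trans (sym (sortedSolid-low b 1≤x′ z′≤2n y′≤n)) eq))) λ ()))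
    -- If the smaller point were absent, its complement would be present and `upper-bound` would
    -- apply to it and to the larger point. Adding the two bounds makes `x`, `z` and their
    -- complements sum to at most `4n`, whereas they sum to `4n + 2`.
    ... | inj₁ y≤n | inj₂ n<y′ = trans (sortedSolid-low b 1≤x z≤2n y≤n)
      (cong not (Bool.¬-not λ up → 1+n≰n (begin-strict
        2 * n + 1 + (2 * n + 1)                             ≡⟨ cong₂ _+_ (m∸n+n≡m x≤) (m∸n+n≡m z≤) ⟨
        complement x + x + (complement z + z)               ≡⟨ shuffle (complement x) x (complement z) z ⟩
        (complement z + complement x) + (x + z)             ≤⟨ +-mono-≤
            (upper-bound {complement z} (complement-low y≤n) (complement-antitone x≤y) (complement≤2n 1≤x) up)
            (≤-trans (+-mono-≤ x≤x′ z≤z′)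
              (upper-bound n<y′ y′≤z′ z′≤2n (trans (sym (sortedSolid-high b 1≤x′ z′≤2n n<y′)) eq))) ⟩
        2 * n + 2 * n                                       <⟨ +-mono-< 2n<2n+1 2n<2n+1 ⟩
        2 * n + 1 + (2 * n + 1)                             ∎)))
      where
      open ≤-Reasoning
      z≤ = ≤2n⇒≤2n+1 z≤2n
      x≤ = ≤-trans x≤y (≤-trans y≤z z≤)
      2n<2n+1 : 2 * n < 2 * n + 1
      2n<2n+1 = ≤-reflexive (+-comm 1 (2 * n))
      shuffle : ∀ p q r s → p + q + (r + s) ≡ (r + p) + (q + s)
      shuffle p q r s = trans (sym (+-assoc (p + q) r s))
        (trans (cong (_+ s) (trans (+-comm (p + q) r) (sym (+-assoc r p q)))) (+-assoc (r + p) q s))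

    -- Complementation exchanges the two clauses: the low case is the definition itself, and the
    -- high case is that definition at the complement with both the negation and the complement
    -- undone.
    sortedSolid-selfCompl : ∀ {x y z} → 1 ≤ x → x ≤ y → y ≤ z → z ≤ 2 * n →
      sortedSolid b x y z ≡ not (sortedSolid b (complement z) (complement y) (complement x))
    sortedSolid-selfCompl {x} {y} {z} 1≤x x≤y y≤z z≤2n with ≤-<-connex y n
    ... | inj₁ y≤n = trans (sortedSolid-low b 1≤x z≤2n y≤n) (cong not (sym
      (sortedSolid-high b (complement-positive z≤2n) (complement≤2n 1≤x) (complement-low y≤n))))
    ... | inj₂ n<y = sym (begin
      not (sortedSolid b (complement z) (complement y) (complement x))
        ≡⟨ cong not (sortedSolid-low b (complement-positive z≤2n) (complement≤2n 1≤x) (complement-high n<y)) ⟩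
      not (not (upper b (complement (complement x)) (complement (complement y)) (complement (complement z))))
        ≡⟨ Bool.not-involutive _ ⟩
      upper b (complement (complement x)) (complement (complement y)) (complement (complement z))
        ≡⟨ cong₃ (upper b) (complement-involutive (≤-trans x≤y y≤2n)) (complement-involutive y≤2n) (complement-involutive z≤2n) ⟩
      upper b x y z
        ≡⟨ sortedSolid-high b 1≤x z≤2n n<y ⟨
      sortedSolid b x y z ∎)
      where
      open ≡-Reasoning
      y≤2n = ≤-trans y≤z z≤2n

    solid-isTSSCPP : IsTSSCPP n (solid b)
    solid-isTSSCPP = record
      { inBox = λ i j k eq →
          let (1≤lo , hi≤2n) = sortedSolid⇒box b {lo i j k} {mid i j k} {hi i j k} eq in
          (≤-trans 1≤lo (≤-trans (m⊓n≤m (i ⊓ j) k) (m⊓n≤m i j)) ,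
           ≤-trans (≤-trans (m≤m⊔n i j) (m≤m⊔n (i ⊔ j) k)) hi≤2n) ,
          (≤-trans 1≤lo (≤-trans (m⊓n≤m (i ⊓ j) k) (m⊓n≤n i j)) ,
           ≤-trans (≤-trans (m≤n⊔m i j) (m≤m⊔n (i ⊔ j) k)) hi≤2n) ,
          (≤-trans 1≤lo (m⊓n≤n (i ⊓ j) k) , ≤-trans (m≤n⊔m (i ⊔ j) k) hi≤2n)
      ; downward = λ i j k i′ j′ k′ eq 1≤i′ i′≤i 1≤j′ j′≤j 1≤k′ k′≤k → sortedSolid-down
          (lo≤mid i′ j′ k′) (mid≤hi i′ j′ k′) (lo≤mid i j k) (mid≤hi i j k)
          (⊓-glb (⊓-glb 1≤i′ 1≤j′) 1≤k′)
          (⊓-mono-≤ (⊓-mono-≤ i′≤i j′≤j) k′≤k)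
          (⊔-mono-≤ (⊔-mono-≤ (⊓-mono-≤ i′≤i j′≤j) (⊓-mono-≤ i′≤i k′≤k)) (⊓-mono-≤ j′≤j k′≤k))
          (⊔-mono-≤ (⊔-mono-≤ i′≤i j′≤j) k′≤k) eq
      ; sym-ikj = s₂₃
      ; sym-jik = s₁₂
      ; sym-jki = λ i j k → trans (s₁₂ i j k) (s₂₃ j i k)
      ; sym-kij = λ i j k → trans (s₂₃ i j k) (s₁₂ i k j)
      ; sym-kji = s₁₃
      ; selfCompl = sorted-suffices
          (λ i j k → InBox (2 * n) i j k →
            solid b i j k ≡ not (solid b (complement i) (complement j) (complement k)))
          (λ {i} {j} {k} h (bi , bj , bk) → trans (s₁₂ j i k) (trans (h (bj , bi , bk)) (cong not (s₁₂ (complement i) (complement j) (complement k)))))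
          (λ {i} {j} {k} h (bi , bj , bk) → trans (s₂₃ i k j) (trans (h (bi , bk , bj)) (cong not (s₂₃ (complement i) (complement j) (complement k)))))
          (λ {x} {y} {z} x≤y y≤z ((1≤x , _) , _ , (_ , z≤2n)) → trans (onSorted-sorted (sortedSolid b) x≤y y≤z)
            (trans (sortedSolid-selfCompl 1≤x x≤y y≤z z≤2n) (cong not (sym (trans (s₁₃ (complement x) (complement y) (complement z))
              (onSorted-sorted (sortedSolid b) (complement-antitone y≤z) (complement-antitone x≤y)))))))
      }
      where
      s₁₂ = onSorted-swap₁₂ (sortedSolid b)
      s₂₃ = onSorted-swap₂₃ (sortedSolid b)
      s₁₃ : ∀ i j k → solid b i j k ≡ solid b k j i
      s₁₃ i j k = trans (s₁₂ i j k) (trans (s₂₃ j i k) (s₁₂ j k i))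

    heights-solid : ∀ i j → InUpper n i j → heights (solid b) i j ≡ b i j
    heights-solid i j (1≤i , i≤j , j≤n) = largest-unique _ n
      (≤-trans (m≤m+n (b i j) j) (bound i j (1≤i , i≤j , j≤n)))
      (λ 1≤b → trans (member 1≤b (≤-trans (m≤m+n (b i j) j) (bound i j (1≤i , i≤j , j≤n)))) (≤⇒≤ᵇ≡true (≤-refl {b i j})))
      (λ 1≤k k≤n eq → ≤ᵇ≡true⇒≤ (trans (sym (member 1≤k k≤n)) eq))
      where
      -- As `k ≤ n`, the triple `k`, `n + i`, `n + j` is already sorted and falls under the high
      -- clause.
      member : ∀ {k} → 1 ≤ k → k ≤ n → solid b (n + i) (n + j) k ≡ (k ≤ᵇ b i j)
      member {k} 1≤k k≤n = begin
        solid b (n + i) (n + j) k         ≡⟨ onSorted-swap₂₃ (sortedSolid b) (n + i) (n + j) k ⟩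
        solid b (n + i) k (n + j)         ≡⟨ onSorted-swap₁₂ (sortedSolid b) (n + i) k (n + j) ⟩
        solid b k (n + i) (n + j)         ≡⟨ onSorted-sorted (sortedSolid b) (≤-trans k≤n (m≤m+n n i)) (+-monoʳ-≤ n i≤j) ⟩
        sortedSolid b k (n + i) (n + j)   ≡⟨ sortedSolid-high b 1≤k n+j≤2n (m<m+n n 1≤i) ⟩
        upper b k (n + i) (n + j)         ≡⟨ cong₂ (λ x y → k ≤ᵇ b x y) (m+n∸m≡n n i) (m+n∸m≡n n j) ⟩
        (k ≤ᵇ b i j)                      ∎
        where
        open ≡-Reasoning
        n+j≤2n : n + j ≤ 2 * n
        n+j≤2n = +-monoʳ-≤ n (≤-trans j≤n (m≤m+n n 0))

  -- From TSSCPPs to excess arrays.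

  module _ {π : PP} (Π : IsTSSCPP n π) where
    open IsTSSCPP Π

    -- (i,j,k) lies above its complement, and exactly one of the two is present.
    corner-absent : ∀ {i j k} → n < i → n < j → n < k → π i j k ≡ false
    corner-absent {i} {j} {k} n<i n<j n<k = Bool.¬-not λ eq →
      let (bi , bj , bk) = inBox i j k eq
          c : ∀ {x} → 1 ≤ x × x ≤ 2 * n → 1 ≤ complement x
          c = λ (_ , x≤) → complement-positive x≤
          d : ∀ {x} → n < x → complement x ≤ x
          d n<x = ≤-trans (complement-high n<x) (<⇒≤ n<x)
      in contradiction (trans (sym eq) (trans (selfCompl i j k (bi , bj , bk)) (cong not
        (downward i j k _ _ _ eq (c bi) (d n<i) (c bj) (d n<j) (c bk) (d n<k))))) λ ()

    -- The column above a cell is downward closed, and `corner-absent` rules out points beyond the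
    -- search limit `n`.
    member-heights : ∀ {i j k} → InUpper n i j → 1 ≤ k → (k ≤ᵇ heights π i j) ≡ π (n + i) (n + j) k
    member-heights {i} {j} {k} (1≤i , i≤j , j≤n) 1≤k = true-ext
      (λ eq → ≤largest⁻¹ _ n
        (λ {x} {y} 1≤x x≤y _ πy → downward _ _ y _ _ x πy
          (≤-trans 1≤i (m≤n+m i n)) ≤-refl (≤-trans (≤-trans 1≤i i≤j) (m≤n+m j n)) ≤-refl 1≤x x≤y)
        1≤k (≤ᵇ≡true⇒≤ eq))
      (λ πk → ≤⇒≤ᵇ≡true (≤largest _ n (≮⇒≥ λ n<k → contradiction
        (trans (sym πk) (corner-absent (m<m+n n 1≤i) (m<m+n n (≤-trans 1≤i i≤j)) n<k)) λ ()) πk))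

    upper-heights : ∀ {x y z} → 1 ≤ x → n < y → y ≤ z → z ≤ 2 * n →
      upper (heights π) x y z ≡ π x y z
    upper-heights {x} {y} {z} 1≤x n<y y≤z z≤2n = begin
      upper (heights π) x y z              ≡⟨ member-heights (upper-region n<y y≤z z≤2n) 1≤x ⟩
      π (n + (y ∸ n)) (n + (z ∸ n)) x      ≡⟨ cong₂ (λ u v → π u v x) (m+[n∸m]≡n (<⇒≤ n<y)) (m+[n∸m]≡n (<⇒≤ (≤-trans n<y y≤z))) ⟩
      π y z x                              ≡⟨ sym-kij y z x ⟩
      π x y z                              ∎
      where open ≡-Reasoning

    heights-isExcess : IsExcess n (heights π)
    heights-isExcess = record
      { bound = bound
      ; decreasingˡ = λ i j 1≤i i<j j≤n → decreasing (1≤i , <⇒≤ i<j , j≤n) (s≤s z≤n , i<j , j≤n) (n≤1+n i) ≤-refl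
      ; decreasingʳ = λ i j 1≤i i≤j j<n → decreasing (1≤i , i≤j , <⇒≤ j<n) (1≤i , m≤n⇒m≤1+n i≤j , j<n) ≤-refl (n≤1+n j)
      }
      where
      decreasing : ∀ {i j i′ j′} → InUpper n i j → InUpper n i′ j′ → i ≤ i′ → j ≤ j′ →
                   heights π i′ j′ ≤ heights π i j
      decreasing {i} {j} {i′} {j′} u@(1≤i , i≤j , _) u′ i≤i′ j≤j′ with heights π i′ j′ in eq
      ... | zero  = z≤n
      ... | suc k = ≤ᵇ≡true⇒≤ (trans (member-heights u (s≤s z≤n)) (downward _ _ (suc k) _ _ _
        (trans (sym (member-heights u′ (s≤s z≤n))) (≤⇒≤ᵇ≡true (≤-reflexive (sym eq))))
        (≤-trans 1≤i (m≤n+m i n)) (+-monoʳ-≤ n i≤i′)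
        (≤-trans (≤-trans 1≤i i≤j) (m≤n+m j n)) (+-monoʳ-≤ n j≤j′) (s≤s z≤n) ≤-refl))

      -- Take `k` to be the complement of `n + j`. If the bound failed, `(n+i , n+j , k)` would be
      -- present and its complement `(c , k , n+j)` absent, where `c` is the complement of `n + i`.
      -- But `(c , n+j , k)` lies below the present point and differs from the absent one only by a
      -- swap.
      bound : ∀ i j → InUpper n i j → heights π i j + j ≤ n
      bound i j u@(1≤i , i≤j , j≤n) = ≮⇒≥ λ n<h+j →
        let k = suc n ∸ j
            1≤k = m<n⇒0<n∸m (s≤s j≤n)
            present : π (n + i) (n + j) k ≡ true
            present = trans (sym (member-heights u 1≤k))
              (≤⇒≤ᵇ≡true (m≤n+o⇒m∸n≤o (suc n) j (≤-trans n<h+j (≤-reflexive (+-comm (heights π i j) j)))))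
            box@(_ , (1≤n+j , n+j≤2n) , (_ , k≤2n)) = inBox _ _ _ present
            absent : π (complement (n + i)) (complement (n + j)) (complement k) ≡ false
            absent = not-true (trans (sym (selfCompl _ _ _ box)) present)
            present′ : π (complement (n + i)) (n + j) k ≡ true
            present′ = downward _ _ _ _ _ _ present
              (complement-positive (proj₂ (proj₁ box)))
              (≤-trans (complement-high (m<m+n n 1≤i)) (m≤m+n n i)) 1≤n+j ≤-refl 1≤k ≤-refl
        in contradiction (trans (sym (trans (sym-ikj _ _ _) present′))
             (subst₂ (λ u v → π (complement (n + i)) u v ≡ false) (complement-n+ j) (complement-k j≤n) absent)) λ ()
        where
        complement-n+ : ∀ j → complement (n + j) ≡ suc n ∸ j
        complement-n+ j = trans (sym (∸-+-assoc (2 * n + 1) n j))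
          (cong (_∸ j) (trans (cong (_∸ n) 2n+1≡n+[1+n]) (m+n∸m≡n n (suc n))))
        complement-k : ∀ {j} → j ≤ n → complement (suc n ∸ j) ≡ n + j
        complement-k {j} j≤n = trans (cong (_∸ (suc n ∸ j)) 2n+1≡n+[1+n])
          (trans (+-∸-assoc n (m∸n≤m (suc n) j)) (cong (λ x → n + x) (m∸[m∸n]≡n (m≤n⇒m≤1+n j≤n))))

    -- Both sides are symmetric, so sorted triples suffice; there `upper-heights` settles the high
    -- clause, and `selfCompl` reduces the low clause to it.
    solid-heights : ∀ i j k → solid (heights π) i j k ≡ π i j k
    solid-heights = sorted-suffices (λ i j k → solid (heights π) i j k ≡ π i j k)
      (λ {i} {j} {k} h → trans (onSorted-swap₁₂ (sortedSolid (heights π)) j i k) (trans h (sym-jik i j k)))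
      (λ {i} {j} {k} h → trans (onSorted-swap₂₃ (sortedSolid (heights π)) i k j) (trans h (sym-ikj i j k)))
      (λ {x} {y} {z} x≤y y≤z → trans (onSorted-sorted (sortedSolid (heights π)) x≤y y≤z) (sortedSolid-unique (heights π)
        (λ eq → let ((1≤x , _) , _ , (_ , z≤2n)) = inBox x y z eq in 1≤x , z≤2n)
        (λ 1≤x z≤2n y≤n → trans
          (selfCompl x y z ((1≤x , ≤-trans x≤y (≤-trans y≤z z≤2n)) ,
            (≤-trans 1≤x x≤y , ≤-trans y≤z z≤2n) , (≤-trans (≤-trans 1≤x x≤y) y≤z , z≤2n)))
          (cong not (trans (sym-kji _ _ _) (sym (upper-heights (complement-positive z≤2n)
            (complement-low y≤n) (complement-antitone x≤y) (complement≤2n 1≤x))))))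
        (λ 1≤x z≤2n n<y → sym (upper-heights 1≤x n<y y≤z z≤2n))))

  upper-cong : ∀ {b b′} → (∀ i j → InUpper n i j → b i j ≡ b′ i j) → ∀ x {y z} →
    n < y → y ≤ z → z ≤ 2 * n → upper b x y z ≡ upper b′ x y z
  upper-cong eq x n<y y≤z z≤2n = cong (x ≤ᵇ_) (eq _ _ (upper-region n<y y≤z z≤2n))

  solid-cong : ∀ {b b′} → (∀ i j → InUpper n i j → b i j ≡ b′ i j) →
    ∀ i j k → solid b i j k ≡ solid b′ i j k
  solid-cong {b} {b′} eq i j k = sortedSolid-unique b (sortedSolid⇒box b′ {lo i j k} {mid i j k} {hi i j k})
    (λ 1≤x z≤2n y≤n → trans (sortedSolid-low b′ 1≤x z≤2n y≤n) (cong not (sym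
      (upper-cong eq (complement (hi i j k)) (complement-low y≤n) (complement-antitone (lo≤mid i j k)) (complement≤2n 1≤x)))))
    (λ 1≤x z≤2n n<y → trans (sortedSolid-high b′ 1≤x z≤2n n<y) (sym (upper-cong eq (lo i j k) n<y (mid≤hi i j k) z≤2n)))

  excess↔tsscpp : Inverse (Excesses n) (TSSCPPs n)
  excess↔tsscpp = strictInverse (Excesses n) (TSSCPPs n)
    (λ (b , B) → solid b , solid-isTSSCPP B)
    (λ (π , Π) → heights π , heights-isExcess Π)
    solid-cong
    (λ eq i j _ → largest-cong _ _ n
      (λ k _ _ → trans (sym (eq (n + i) (n + j) k))) (λ k _ _ → trans (eq (n + i) (n + j) k)))
    (λ (π , Π) → solid-heights Π)
    (λ (b , B) → heights-solid B)

theorem3p2 : (n : ℕ) → 1 ≤ n →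
    Bijection (MagogMatrices n) (MagogTriangles n) × Bijection (MagogMatrices n) (TSSCPPs n)
theorem3p2 n _ =
  Inverse⇒Bijection (inverse matrix↔tri (tri↔triangle n)) ,
  Inverse⇒Bijection (inverse matrix↔tri (inverse (tri↔excess n) (excess↔tsscpp n)))
  where
  matrix↔tri : Inverse (MagogMatrices n) (NatTriangles n)
  matrix↔tri = inverse (matrix↔corner n) (corner↔tri n)
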